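{- Let $n\ge 2$. Let $\pi,\sigma\in\mathfrak{B}_n$ have respective length vectors $(\ell_1,\ell_2,\ell_3,\ell_4)$ and $(m_1,m_2,m_3,m_4)$, and suppose $\pi\le\sigma$. Let $r=\ell_1-m_1+\ell_4-m_4$. Then there are exactly $\binom{r}{\ell_1-m_1}\binom{r}{m_2-\ell_2}$ saturated chains $\pi=\pi_1\vartriangleleft\pi_2\vartriangleleft\cdots\vartriangleleft\pi_{r+1}=\sigma$ (with $r$ covering steps) between $\pi$ and $\sigma$ in $(\mathfrak{B}_n,\le)$. Moreover, there are exactly $4^{n-2}$ maximal chains in $(\mathfrak{B}_n,\le)$.
   Context: $\mathfrak{S}_n$ is the set of permutations of $[n]=\{1,\dots,n\}$, in one-line notation. A reduction of $\omega\in\mathfrak{S}_n$ interchanges $\omega(i)$ and $\omega(j)$ for some $i<j$ with $\omega(i)>\omega(j)$. Bruhat order: $\pi\le\sigma$ if $\pi$ is obtained from $\sigma$ by a (possibly empty) sequence of reductions. $\mathfrak{B}_n\subseteq\mathfrak{S}_n$ is the set of bigrassmannian permutations (both $\omega$ and $\omega^{ -1}$ have exactly one descent), with the order inherited from Bruhat order; equivalently $\omega=1\cdots a\,(b+1)\cdots c\,(a+1)\cdots b\,(c+1)\cdots n$ for a unique triple $0\le a<b<c\le n$. The length vector of such an element is $(\ell_1,\ell_2,\ell_3,\ell_4)=(a+1,b-a,c-b,n+1-c)$. $\pi\vartriangleleft\sigma$ means $\sigma$ covers $\pi$ in $\mathfrak{B}_n$: $\pi<\sigma$ and no $\rho\in\mathfrak{B}_n$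 has $\pi<\rho<\sigma$. A maximal chain is a saturated chain (consecutive elements related by $\vartriangleleft$) connecting a minimal element and a maximal element of $(\mathfrak{B}_n,\le)$. -}

module Defs where

open import Data.Fin as Fin using (Fin; toℕ)
open import Data.Fin.Permutation using (Permutation′; _≈_; _⟨$⟩ʳ_; _∘ₚ_; flip; transpose)
open import Data.Integer using (ℤ; +_; -[1+_])
open import Data.List using (List; allFin; applyUpTo; map; _++_)
open import Data.Nat using (ℕ; suc; _+_; _∸_; _<_; _≤_)
open import Data.Nat.Combinatorics using (_C_)
open import Data.Product using (Σ; ∃; ∃-syntax; ∃!; _×_; proj₁)
open import Data.Vec using (Vec; head; last)
open import Data.Vec.Relation.Binary.Pointwise.Inductive as Pointwise using (Pointwise)
open import Data.Vec.Relation.Unary.Linked using (Linked)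
open import Function.Bundles using (Inverse)
open import Level using (0ℓ)
open import Relation.Binary.Bundles using (Setoid)
open import Relation.Binary.Construct.Closure.ReflexiveTransitive using (Star)
import Relation.Binary.Construct.NonStrictToStrict as NonStrictToStrict
import Relation.Binary.Construct.On as On
open import Relation.Binary.Core using (Rel)
open import Relation.Binary.PropositionalEquality using (_≡_; refl; sym; trans; setoid)
open import Relation.Nullary using (¬_)

private
  variable
    n : ℕ

-- Positions and values of a permutation are elements of Fin n, hence shifted
-- by one relative to [n]; oneLine shifts the values back to 1, …, n.

oneLine : Permutation′ n → List ℕ
oneLine {n} ω = map (λ i → suc (toℕ (ω ⟨$⟩ʳ i))) (allFin n)

-- transpose i j ∘ₚ σ applies the transposition first, so it interchanges the
-- entries of σ at the positions i and j.

Reduction : Rel (Permutation′ n) 0ℓ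
Reduction σ π = ∃[ i ] ∃[ j ] i Fin.< j × σ ⟨$⟩ʳ j Fin.< σ ⟨$⟩ʳ i × π ≈ transpose i j ∘ₚ σ

-- The final _≈_ is needed because the empty sequence in Star would otherwise
-- force propositional, not extensional, equality of permutations.

infix 4 _≤ᴮ_

_≤ᴮ_ : Rel (Permutation′ n) 0ℓ
π ≤ᴮ σ = ∃[ ρ ] Star Reduction σ ρ × ρ ≈ π

Descent : Permutation′ n → Fin n → Set
Descent ω i = ∃[ j ] toℕ j ≡ suc (toℕ i) × ω ⟨$⟩ʳ j Fin.< ω ⟨$⟩ʳ i

HasOneDescent : Permutation′ n → Set
HasOneDescent ω = ∃! _≡_ (Descent ω)

Bigrassmannian : Permutation′ n → Set
Bigrassmannian ω = HasOneDescent ω × HasOneDescent (flip ω)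

𝔅 : ℕ → Set
𝔅 n = Σ (Permutation′ n) Bigrassmannian

infix 4 _≈𝔅_ _≤𝔅_ _<𝔅_ _◁_

_≈𝔅_ : Rel (𝔅 n) 0ℓ
π ≈𝔅 σ = proj₁ π ≈ proj₁ σ

_≤𝔅_ : Rel (𝔅 n) 0ℓ
π ≤𝔅 σ = proj₁ π ≤ᴮ proj₁ σ

_<𝔅_ : Rel (𝔅 n) 0ℓ
_<𝔅_ = NonStrictToStrict._<_ _≈𝔅_ _≤𝔅_

_◁_ : Rel (𝔅 n) 0ℓ
π ◁ σ = π <𝔅 σ × ¬ (∃[ ρ ] π <𝔅 ρ × ρ <𝔅 σ)

Minimal : 𝔅 n → Set
Minimal π = ∀ ρ → ρ ≤𝔅 π → ρ ≈𝔅 π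

Maximal : 𝔅 n → Set
Maximal π = ∀ ρ → π ≤𝔅 ρ → ρ ≈𝔅 π

-- block a b is the list a+1, …, b.

block : ℕ → ℕ → List ℕ
block a b = applyUpTo (λ k → suc (a + k)) (b ∸ a)

-- All subtractions are exact because a < b < c ≤ n.

HasLengthVector : 𝔅 n → (ℓ₁ ℓ₂ ℓ₃ ℓ₄ : ℕ) → Set
HasLengthVector {n} ω ℓ₁ ℓ₂ ℓ₃ ℓ₄ =
  ∃[ a ] ∃[ b ] ∃[ c ]
    (a < b × b < c × c ≤ n)
    × oneLine (proj₁ ω) ≡ block 0 a ++ block b c ++ block a b ++ block c n
    × (ℓ₁ ≡ suc a × ℓ₂ ≡ b ∸ a × ℓ₃ ≡ c ∸ b × ℓ₄ ≡ suc n ∸ c)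

record SaturatedChain (n : ℕ) : Set where
  field
    steps    : ℕ
    elements : Vec (𝔅 n) (suc steps)
    covers   : Linked _◁_ elements

  start end : 𝔅 n
  start = head elements
  end   = last elements

open SaturatedChain public

-- Two chains are equal when they have the same length and list the same
-- permutations; Pointwise relates vectors of equal length only.

chainSetoid : ℕ → Setoid 0ℓ 0ℓ
chainSetoid n = record
  { Carrier       = SaturatedChain n
  ; _≈_           = λ x y → Pointwise _≈𝔅_ (elements x) (elements y)
  ; isEquivalence = record
    { refl  = Pointwise.refl (λ _ → refl)
    ; sym   = Pointwise.sym (λ p i → sym (p i))
    ; trans = Pointwise.trans (λ p q i → trans (p i) (q i))
    }
  }

chainsSatisfying : (SaturatedChain n → Set) → Setoid 0ℓ 0ℓ
chainsSatisfying {n} P = On.setoid {B = Σ (SaturatedChain n) P} (chainSetoid n) proj₁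

Between : 𝔅 n → 𝔅 n → SaturatedChain n → Set
Between π σ x = start x ≈𝔅 π × end x ≈𝔅 σ

MaximalChain : SaturatedChain n → Set
MaximalChain x = Minimal (start x) × Maximal (end x)

HasCardinality : Setoid 0ℓ 0ℓ → ℕ → Set
HasCardinality S k = Inverse S (setoid (Fin k))

-- The parameters of the binomial coefficients are differences, hence integers;
-- a negative argument gives 0.

binomial : ℤ → ℤ → ℕ
binomial (+ m)    (+ k)    = m C k
binomial (+ _)    -[1+ _ ] = 0
binomial -[1+ _ ] _        = 0

{-# OPTIONS --safe #-}

-- Record a bigrassmannian permutation by its outer pair (ℓ₁ − 1 , ℓ₄ − 1) and its inner pair
-- (ℓ₂ − 1 , ℓ₃ − 1). A reduction never increases the largest displacement of an entry upwards or
-- downwards, and it keeps initial and final segments of fixed points; for the triple (a,b,c) these four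
-- data are b − a, c − b, a and n − c. Hence π ≤ σ forces outer σ ≤ outer π and inner π ≤ inner σ
-- componentwise. Conversely, moving one unit from the outer to the inner pair is achieved by a cyclic
-- shift of consecutive entries, or of consecutive values, which is a product of reductions. So the
-- covering steps are exactly the moves of one unit, each described by two independent binary choices
-- (which outer entry drops, which inner entry grows), and a saturated chain amounts to a pair of binary
-- words of the same length. The end points prescribe the numbers of letters of each kind; for maximal
-- chains, which run from inner = (0 , 0) to outer = (0 , 0), both words are arbitrary.

module Submission where

open import Defs
open import Data.Bool using (Bool; true; false)
open import Data.Fin as Fin using (Fin; toℕ; fromℕ<)
open import Data.Fin.Permutation
  using (Permutation′; permutation; _≈_; _⟨$⟩ʳ_; _⟨$⟩ˡ_; _∘ₚ_; flip; transpose; inverseˡ; inverseʳ)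
open import Data.Fin.Properties
  using (toℕ-injective; toℕ-fromℕ<; toℕ<n; toℕ-inject; _≟_; ¬∀⟶∃¬-smallest; +↔⊎; *↔×; 1↔⊤; 0↔⊥; 2↔Bool)
  renaming (≤∧≢⇒< to Fin-≤∧≢⇒<)
open import Data.List using (List; []; _∷_; length; applyUpTo; tabulate; map; _++_)
open import Data.List.Properties using (length-applyUpTo; ∷-injective)
open import Data.Nat using (ℕ; zero; suc; _+_; _*_; _∸_; _^_; _≤_; _<_; z≤n; s≤s; s≤s⁻¹; _<?_)
open import Data.Nat.Combinatorics using (_C_; nCk+nC[k+1]≡[n+1]C[k+1])
open import Data.Nat.Properties hiding (_≟_; _<?_)
open import Algebra.Properties.CommutativeSemigroup +-commutativeSemigroup
  using (interchange; x∙yz≈y∙xz; xy∙z≈xz∙y)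
open import Data.Nat.Tactic.RingSolver using (solve-∀)
open import Data.Product using (Σ; ∃-syntax; ∃₂; _×_; _,_; proj₁; proj₂)
open import Data.Product.Function.NonDependent.Propositional using (_×-↔_)
open import Data.Sum using (_⊎_; inj₁; inj₂)
open import Data.Sum.Function.Propositional using (_⊎-↔_)
open import Data.Vec using (Vec; []; _∷_; head; last)
open import Data.Vec.Relation.Binary.Pointwise.Inductive using (Pointwise; []; _∷_)
open import Data.Vec.Relation.Unary.Linked using (Linked; [-]; _∷_)
open import Function.Bundles using (_↔_; mk↔ₛ′; Bijection)
open import Function.Construct.Composition using (_↔-∘_; inverse)
open import Function.Construct.Symmetry using (↔-sym)
open import Function.Properties.Bijection using (Bijection⇒Inverse)
open import Level using (0ℓ)
open import Relation.Binary.Bundles using (Setoid)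
open import Relation.Binary.Construct.Closure.ReflexiveTransitive using (Star; ε; _◅_; _◅◅_; gmap)
open import Relation.Binary.PropositionalEquality
open import Relation.Nullary using (¬_; Dec; contradiction; yes; no)

private
  variable
    n : ℕ
    X Y : Set

-- Binary words

bump : Bool → ℕ × ℕ → ℕ × ℕ
bump true  (x , y) = suc x , y
bump false (x , y) = x , suc y

size : ℕ × ℕ → ℕ
size (x , y) = x + y

infix 4 _≤²_

_≤²_ : ℕ × ℕ → ℕ × ℕ → Set
(x , y) ≤² (x′ , y′) = x ≤ x′ × y ≤ y′

≤²-refl : ∀ {p} → p ≤² p
≤²-refl = ≤-refl , ≤-refl

≤²-antisym : ∀ {p q} → p ≤² q → q ≤² p → p ≡ q
≤²-antisym (x≤ , y≤) (≤x , ≤y) = cong₂ _,_ (≤-antisym x≤ ≤x) (≤-antisym y≤ ≤y)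

size-mono : ∀ {p q} → p ≤² q → size p ≤ size q
size-mono (x≤ , y≤) = +-mono-≤ x≤ y≤

-- A gain in one coordinate would have to be paid for by a loss in the other.
≤²-size-≡ : ∀ {p q} → p ≤² q → size p ≡ size q → p ≡ q
≤²-size-≡ {x , y} {x′ , y′} (x≤ , y≤) eq = ≤²-antisym (x≤ , y≤) (x′≤x , y′≤y)
  where
  x′≤x : x′ ≤ x
  x′≤x = +-cancelʳ-≤ y′ x′ x (≤-trans (≤-reflexive (sym eq)) (+-monoʳ-≤ x y≤))
  y′≤y : y′ ≤ y
  y′≤y = +-cancelˡ-≤ x′ y′ y (≤-trans (≤-reflexive (sym eq)) (+-monoˡ-≤ y x≤))

size-bump : ∀ β p → size (bump β p) ≡ suc (size p)
size-bump true  (x , y) = refl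
size-bump false (x , y) = +-suc x y

-- Moving one unit between an outer and an inner pair keeps their total, which is the condition for
-- the new pairs to belong to a permutation of the same `n`.
size-exchange : ∀ β p γ q → size p + size (bump γ q) ≡ size (bump β p) + size q
size-exchange β p γ q = trans (cong (size p +_) (size-bump γ q))
  (trans (+-suc (size p) (size q)) (cong (_+ size q) (sym (size-bump β p))))

≤²-bump : ∀ β p → p ≤² bump β p
≤²-bump true  (x , y) = n≤1+n x , ≤-refl
≤²-bump false (x , y) = ≤-refl , n≤1+n y

≢-bump : ∀ β p → p ≢ bump β p
≢-bump true  (x , y) eq = 1+n≢n (sym (cong proj₁ eq))
≢-bump false (x , y) eq = 1+n≢n (sym (cong proj₂ eq))

bump-injectiveˡ : ∀ {β β′} p → bump β p ≡ bump β′ p → β ≡ β′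
bump-injectiveˡ {true}  {true}  p eq = refl
bump-injectiveˡ {true}  {false} p eq = contradiction (cong proj₁ eq) 1+n≢n
bump-injectiveˡ {false} {true}  p eq = contradiction (sym (cong proj₁ eq)) 1+n≢n
bump-injectiveˡ {false} {false} p eq = refl

bump-injectiveʳ : ∀ β {p q} → bump β p ≡ bump β q → p ≡ q
bump-injectiveʳ true  refl = refl
bump-injectiveʳ false refl = refl

bump-comm : ∀ β γ p → bump β (bump γ p) ≡ bump γ (bump β p)
bump-comm true  true  p = refl
bump-comm true  false p = refl
bump-comm false true  p = refl
bump-comm false false p = refl

-- A larger sum forces a strict inequality in some coordinate, and a unit is taken from that
-- coordinate of `q`. `≤²-bump⁺` adds it to `p` instead: going up in the order, outer pairs shrink
-- and inner pairs grow.
≤²-bump⁻ : ∀ {p q} → p ≤² q → size p < size q → ∃₂ λ β r → q ≡ bump β r × p ≤² r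
≤²-bump⁻ {x , y} {x′ , y′} (x≤ , y≤) lt with m≤n⇒m<n∨m≡n x≤ | m≤n⇒m<n∨m≡n y≤
≤²-bump⁻ {x , y} {suc x′ , y′} (x≤ , y≤) lt | inj₁ x<  | _ = true , (x′ , y′) , refl , (s≤s⁻¹ x< , y≤)
≤²-bump⁻ {x , y} {x′ , suc y′} (x≤ , y≤) lt | inj₂ _   | inj₁ y< = false , (x′ , y′) , refl , (x≤ , s≤s⁻¹ y<)
≤²-bump⁻ {x , y} {x′ , y′} (x≤ , y≤) lt | inj₂ refl | inj₂ refl = contradiction lt (<-irrefl refl)

≤²-bump⁺ : ∀ {p q} → p ≤² q → size p < size q → ∃[ β ] bump β p ≤² q
≤²-bump⁺ {x , y} {x′ , y′} (x≤ , y≤) lt with m≤n⇒m<n∨m≡n x≤ | m≤n⇒m<n∨m≡n y≤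
... | inj₁ x<   | _         = true , x< , y≤
... | inj₂ _    | inj₁ y<   = false , x≤ , y<
... | inj₂ refl | inj₂ refl = contradiction lt (<-irrefl refl)

bumps : List Bool → ℕ × ℕ → ℕ × ℕ
bumps []      p = p
bumps (β ∷ w) p = bump β (bumps w p)

bumps-bump : ∀ w γ p → bumps w (bump γ p) ≡ bump γ (bumps w p)
bumps-bump []      γ p = refl
bumps-bump (β ∷ w) γ p = trans (cong (bump β) (bumps-bump w γ p)) (bump-comm β γ (bumps w p))

bumps-injectiveʳ : ∀ w {p q} → bumps w p ≡ bumps w q → p ≡ q
bumps-injectiveʳ []      eq = eq
bumps-injectiveʳ (β ∷ w) eq = bumps-injectiveʳ w (bump-injectiveʳ β eq)

size-bumps : ∀ w p → size (bumps w p) ≡ length w + size p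
size-bumps []      p = refl
size-bumps (β ∷ w) p = trans (size-bump β (bumps w p)) (cong suc (size-bumps w p))

trues : List Bool → ℕ
trues []          = 0
trues (true  ∷ w) = suc (trues w)
trues (false ∷ w) = trues w

proj₁-bumps : ∀ w p → proj₁ (bumps w p) ≡ trues w + proj₁ p
proj₁-bumps []          p = refl
proj₁-bumps (true  ∷ w) p = cong suc (proj₁-bumps w p)
proj₁-bumps (false ∷ w) p = proj₁-bumps w p

Word : ℕ → Set
Word r = Σ (List Bool) λ w → length w ≡ r

Word-≡ : ∀ {r} {w w′ : Word r} → proj₁ w ≡ proj₁ w′ → w ≡ w′
Word-≡ {w = w , p} {w′ = _ , p′} refl = cong (w ,_) (≡-irrelevant p p′)

MarkedWord : ℕ → ℕ → Set
MarkedWord r k = Σ (List Bool) λ w → length w ≡ r × trues w ≡ k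

MarkedWord-≡ : ∀ {r k} {w w′ : MarkedWord r k} → proj₁ w ≡ proj₁ w′ → w ≡ w′
MarkedWord-≡ {w = w , p , q} {w′ = _ , p′ , q′} refl =
  cong₂ (λ p q → w , p , q) (≡-irrelevant p p′) (≡-irrelevant q q′)

words : ∀ r → Word r ↔ Fin (2 ^ r)
words zero    = ↔-sym 1↔⊤ ↔-∘ mk↔ₛ′ _ (λ _ → [] , refl) (λ _ → refl) λ { ([] , _) → Word-≡ refl }
words (suc r) = ↔-sym *↔× ↔-∘ ((↔-sym 2↔Bool ×-↔ words r) ↔-∘ mk↔ₛ′ to from
  (λ { (β , w) → cong (β ,_) (Word-≡ refl) })
  (λ { (_ ∷ _ , _) → Word-≡ refl }))
  where
  to : Word (suc r) → Bool × Word r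
  to (β ∷ w , eq) = β , w , suc-injective eq
  from : Bool × Word r → Word (suc r)
  from (β , w , eq) = β ∷ w , cong suc eq

-- Splitting by the first letter is Pascal's rule: after `true` one mark less remains to be placed.
markedWords : ∀ r k → MarkedWord r k ↔ Fin (r C k)
markedWords zero zero = ↔-sym 1↔⊤ ↔-∘
  mk↔ₛ′ _ (λ _ → [] , refl , refl) (λ _ → refl) λ { ([] , _) → MarkedWord-≡ refl }
markedWords zero (suc k) = ↔-sym 0↔⊥ ↔-∘
  mk↔ₛ′ (λ { ([] , _ , ()) }) (λ ()) (λ ()) (λ { ([] , _ , ()) })
-- No mark is left, so the first letter is `false`; `suc r C zero` and `r C zero` agree by
-- computation.
markedWords (suc r) zero = markedWords r zero ↔-∘ mk↔ₛ′ to from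
  (λ _ → MarkedWord-≡ refl)
  (λ { (false ∷ _ , _) → MarkedWord-≡ refl })
  where
  to : MarkedWord (suc r) zero → MarkedWord r zero
  to (false ∷ w , p , q) = w , suc-injective p , q
  from : MarkedWord r zero → MarkedWord (suc r) zero
  from (w , p , q) = false ∷ w , cong suc p , q
markedWords (suc r) (suc k) = subst (λ N → MarkedWord (suc r) (suc k) ↔ Fin N)
  (nCk+nC[k+1]≡[n+1]C[k+1] r k)
  (↔-sym +↔⊎ ↔-∘ ((markedWords r k ⊎-↔ markedWords r (suc k)) ↔-∘ mk↔ₛ′ to from
    (λ { (inj₁ _) → cong inj₁ (MarkedWord-≡ refl) ; (inj₂ _) → cong inj₂ (MarkedWord-≡ refl) })
    (λ { (true ∷ _ , _) → MarkedWord-≡ refl ; (false ∷ _ , _) → MarkedWord-≡ refl })))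
  where
  to : MarkedWord (suc r) (suc k) → MarkedWord r k ⊎ MarkedWord r (suc k)
  to (true  ∷ w , p , q) = inj₁ (w , suc-injective p , suc-injective q)
  to (false ∷ w , p , q) = inj₂ (w , suc-injective p , q)
  from : MarkedWord r k ⊎ MarkedWord r (suc k) → MarkedWord (suc r) (suc k)
  from (inj₁ (w , p , q)) = true  ∷ w , cong suc p , cong suc q
  from (inj₂ (w , p , q)) = false ∷ w , cong suc p , q

-- Block structure of a bigrassmannian permutation

-- w(k) = l in zero-based notation for w = 1⋯a (b+1)⋯c (a+1)⋯b (c+1)⋯n, where U = b − a and V = c − b.

data Piece (a U V k l : ℕ) : Set where
  fixedˡ  : k < a → l ≡ k → Piece a U V k l
  raised  : a ≤ k → k < a + V → l ≡ k + U → Piece a U V k l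
  lowered : a + V ≤ k → k < a + V + U → l + V ≡ k → Piece a U V k l
  fixedʳ  : a + V + U ≤ k → l ≡ k → Piece a U V k l

module _ {a U V : ℕ} where

  piece-total : ∀ k → ∃[ l ] Piece a U V k l
  piece-total k with k <? a | k <? a + V | k <? a + V + U
  ... | yes k<a | _       | _       = k , fixedˡ k<a refl
  ... | no  k≮a | yes k<b | _       = k + U , raised (≮⇒≥ k≮a) k<b refl
  ... | no  _   | no  k≮b | yes k<c = k ∸ V ,
    lowered (≮⇒≥ k≮b) k<c (m∸n+n≡m (≤-trans (m≤n+m V a) (≮⇒≥ k≮b)))
  ... | no  _   | no  _   | no  k≮c = k , fixedʳ (≮⇒≥ k≮c) refl

  -- Inversion interchanges the lengths of the two middle blocks and turns raised entries into
  -- lowered ones. Statements about positions thereby yield statements about values.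
  piece-flip : ∀ {k l} → Piece a U V k l → Piece a V U l k
  piece-flip (fixedˡ k<a refl) = fixedˡ k<a refl
  piece-flip {k} (raised a≤k k<b refl) = lowered
    (+-monoˡ-≤ U a≤k)
    (≤-trans (+-monoˡ-< U k<b) (≤-reflexive (xy∙z≈xz∙y a V U)))
    refl
  piece-flip {l = l} (lowered b≤k k<c refl) = raised
    (+-cancelʳ-≤ V a l b≤k)
    (+-cancelʳ-< V l (a + U) (≤-trans k<c (≤-reflexive (xy∙z≈xz∙y a V U))))
    refl
  piece-flip (fixedʳ c≤k refl) = fixedʳ (≤-trans (≤-reflexive (xy∙z≈xz∙y a U V)) c≤k) refl

  private
    a≤b : a ≤ a + V
    a≤b = m≤m+n a V
    b≤c : a + V ≤ a + V + U
    b≤c = m≤m+n (a + V) U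
    a≤c : a ≤ a + V + U
    a≤c = ≤-trans a≤b b≤c

    clash : ∀ {k x y} {A : Set} → k < x → x ≤ y → y ≤ k → A
    clash k<x x≤y y≤k = contradiction (<-≤-trans k<x (≤-trans x≤y y≤k)) (<-irrefl refl)

  piece-unique : ∀ {k l l′} → Piece a U V k l → Piece a U V k l′ → l ≡ l′
  piece-unique (fixedˡ _ refl)    (fixedˡ _ refl)    = refl
  piece-unique (fixedˡ p _)       (raised q _ _)     = clash p ≤-refl q
  piece-unique (fixedˡ p _)       (lowered q _ _)    = clash p a≤b q
  piece-unique (fixedˡ p _)       (fixedʳ q _)       = clash p a≤c q
  piece-unique (raised q _ _)     (fixedˡ p _)       = clash p ≤-refl q
  piece-unique (raised _ _ refl)  (raised _ _ refl)  = refl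
  piece-unique (raised _ p _)     (lowered q _ _)    = clash p ≤-refl q
  piece-unique (raised _ p _)     (fixedʳ q _)       = clash p b≤c q
  piece-unique (lowered q _ _)    (fixedˡ p _)       = clash p a≤b q
  piece-unique (lowered q _ _)    (raised _ p _)     = clash p ≤-refl q
  piece-unique {l = l} {l′} (lowered _ _ e) (lowered _ _ e′) = +-cancelʳ-≡ V l l′ (trans e (sym e′))
  piece-unique (lowered _ p _)    (fixedʳ q _)       = clash p ≤-refl q
  piece-unique (fixedʳ q _)       (fixedˡ p _)       = clash p a≤c q
  piece-unique (fixedʳ q _)       (raised _ p _)     = clash p b≤c q
  piece-unique (fixedʳ q _)       (lowered _ p _)    = clash p ≤-refl q
  piece-unique (fixedʳ _ refl)    (fixedʳ _ refl)    = refl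

  piece-< : ∀ {k l n} → Piece a U V k l → a + V + U ≤ n → k < n → l < n
  piece-< (fixedˡ _ refl)       c≤n k<n = k<n
  piece-< (raised _ k<b refl)   c≤n k<n = <-≤-trans (+-monoˡ-< U k<b) c≤n
  piece-< {l = l} (lowered _ _ refl) c≤n k<n = ≤-<-trans (m≤m+n l V) k<n
  piece-< (fixedʳ _ refl)       c≤n k<n = k<n

  -- Entries increase inside each block, on entering the raised block and on leaving the lowered
  -- one; only the passage between these two is left.
  piece-descent : ∀ {k l l′} → Piece a U V k l → Piece a U V (suc k) l′ → l′ < l → suc k ≡ a + V
  piece-descent (fixedˡ _ refl) (fixedˡ _ refl) d = contradiction (n≤1+n _) (<⇒≱ d)
  piece-descent {k} (fixedˡ _ refl) (raised _ _ refl) d = contradiction (≤-trans (n≤1+n k) (m≤m+n _ U)) (<⇒≱ d)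
  -- Only an empty raised block, `V = 0`, allows this passage; the bounds then give the equation.
  piece-descent (fixedˡ p _) (lowered q _ _) d = ≤-antisym (≤-trans p a≤b) q
  piece-descent (fixedˡ _ refl) (fixedʳ _ refl) d = contradiction (n≤1+n _) (<⇒≱ d)
  piece-descent (raised q _ _) (fixedˡ p _) d = clash (<-trans (n<1+n _) p) ≤-refl q
  piece-descent {k} (raised _ _ refl) (raised _ _ refl) d = contradiction (+-monoˡ-≤ U (n≤1+n k)) (<⇒≱ d)
  piece-descent (raised _ p _) (lowered q _ _) d = ≤-antisym p q
  piece-descent (raised _ p _) (fixedʳ q _) d = ≤-antisym p (≤-trans b≤c q)
  piece-descent (lowered q _ _) (fixedˡ p _) d = clash (<-trans (n<1+n _) p) a≤b q
  piece-descent (lowered q _ _) (raised _ p _) d = clash (<-trans (n<1+n _) p) ≤-refl q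
  piece-descent {l = l} {l′} (lowered _ _ refl) (lowered _ _ e) d =
    contradiction (+-monoˡ-< V d) (≤⇒≯ (≤-trans (n≤1+n _) (≤-reflexive (sym e))))
  piece-descent {l = l} (lowered _ _ refl) (fixedʳ _ refl) d =
    contradiction (≤-trans (m≤m+n l V) (n≤1+n _)) (<⇒≱ d)
  piece-descent (fixedʳ q _) (fixedˡ p _) d = clash (<-trans (n<1+n _) p) a≤c q
  piece-descent (fixedʳ q _) (raised _ p _) d = clash (<-trans (n<1+n _) p) b≤c q
  piece-descent (fixedʳ q _) (lowered _ p _) d = clash (<-trans (n<1+n _) p) ≤-refl q
  piece-descent (fixedʳ _ refl) (fixedʳ _ refl) d = contradiction (n≤1+n _) (<⇒≱ d)

-- The pairs are (ℓ₁ − 1 , ℓ₄ − 1) and (ℓ₂ − 1 , ℓ₃ − 1).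

record Shape (ω : Permutation′ n) (outer inner : ℕ × ℕ) : Set where
  constructor shape
  field
    total : proj₁ outer + suc (proj₂ inner) + suc (proj₁ inner) + proj₂ outer ≡ n
    piece : ∀ k → Piece (proj₁ outer) (suc (proj₁ inner)) (suc (proj₂ inner)) (toℕ k) (toℕ (ω ⟨$⟩ʳ k))

open Shape

module _ {ω : Permutation′ n} {a y u v} (s : Shape ω (a , y) (u , v)) where

  end≤n : a + suc v + suc u ≤ n
  end≤n = ≤-trans (m≤m+n _ y) (≤-reflexive (total s))

  -- The equation for `toℕ i` lets the permutation be evaluated at positions that `at` supplies.
  value : ∀ {k l} i → toℕ i ≡ k → Piece a (suc u) (suc v) k l → toℕ (ω ⟨$⟩ʳ i) ≡ l
  value i refl = piece-unique (piece s i)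

-- The 2 collects the two `suc`s of the nonempty middle blocks.
size-total : ∀ a y u v → a + y + (u + v) + 2 ≡ a + suc v + suc u + y
size-total = solve-∀

shape-flip : ∀ {ω : Permutation′ n} {o u v} → Shape ω o (u , v) → Shape (flip ω) o (v , u)
shape-flip {ω = ω} {a , y} {u} {v} s = shape
  (trans (cong (_+ y) (xy∙z≈xz∙y a (suc u) (suc v))) (total s))
  (λ k → piece-flip (subst (Piece _ _ _ _) (cong toℕ (inverseʳ ω)) (piece s (ω ⟨$⟩ˡ k))))

shape-≈ : ∀ {π ω : Permutation′ n} {o i} → Shape π o i → Shape ω o i → π ≈ ω
shape-≈ s t k = toℕ-injective (value s k refl (piece t k))

at : ∀ {k} → k < n → ∃[ i ] toℕ {n} i ≡ k
at k<n = fromℕ< k<n , toℕ-fromℕ< k<n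

-- The descent lies between the last raised entry, at position `a + v`, and the first lowered one,
-- whose value is `a`; `piece-descent` rules out any other.
shape-descent : ∀ {ω : Permutation′ n} {o i} → Shape ω o i → HasOneDescent ω
shape-descent {n} {ω} {a , y} {u , v} s = i , (j , trans j≡ (cong suc (sym i≡)) , ωj<ωi) , unique
  where
  b<n : a + suc v < n
  b<n = <-≤-trans (m<m+n (a + suc v) (s≤s z≤n)) (end≤n s)
  b-1<n : a + v < n
  b-1<n = <-trans (+-monoʳ-< a (n<1+n v)) b<n
  i j : Fin n
  i = proj₁ (at b-1<n)
  j = proj₁ (at b<n)
  i≡ : toℕ i ≡ a + v
  i≡ = proj₂ (at b-1<n)
  j≡ : toℕ j ≡ suc (a + v)
  j≡ = trans (proj₂ (at b<n)) (+-suc a v)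
  ωi : toℕ (ω ⟨$⟩ʳ i) ≡ a + v + suc u
  ωi = value s i i≡ (raised (m≤m+n a v) (+-monoʳ-< a (n<1+n v)) refl)
  ωj : toℕ (ω ⟨$⟩ʳ j) ≡ a
  ωj = value s j (proj₂ (at b<n)) (lowered ≤-refl (m<m+n (a + suc v) (s≤s z≤n)) refl)
  ωj<ωi : toℕ (ω ⟨$⟩ʳ j) < toℕ (ω ⟨$⟩ʳ i)
  ωj<ωi = subst₂ _<_ (sym ωj) (sym ωi) (≤-<-trans (m≤m+n a v) (m<m+n (a + v) (s≤s z≤n)))
  unique : ∀ {k} → Descent ω k → i ≡ k
  unique {k} (k′ , k′≡ , d) = toℕ-injective (trans i≡ (suc-injective (sym
    (trans (piece-descent (piece s k) (subst (λ x → Piece _ _ _ x (toℕ (ω ⟨$⟩ʳ k′))) k′≡ (piece s k′)) d) (+-suc a v)))))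

shape-bigrassmannian : ∀ {ω : Permutation′ n} {o i} → Shape ω o i → Bigrassmannian ω
shape-bigrassmannian s = shape-descent s , shape-descent (shape-flip s)

module _ (a U V : ℕ) (c≤n : a + V + U ≤ n) where

  pieceMap : Fin n → Fin n
  pieceMap k = fromℕ< (piece-< (proj₂ (piece-total {a} {U} {V} (toℕ k))) c≤n (toℕ<n k))

  pieceMap-piece : ∀ k → Piece a U V (toℕ k) (toℕ (pieceMap k))
  pieceMap-piece k = subst (Piece a U V (toℕ k)) (sym (toℕ-fromℕ< _)) (proj₂ (piece-total (toℕ k)))

-- After `piece-flip` both sides are values of the same piecewise map at the same point.
pieceMap-inverse : ∀ a U V (c≤n : a + V + U ≤ n) (c≤n′ : a + U + V ≤ n) k →
  pieceMap a U V c≤n (pieceMap a V U c≤n′ k) ≡ k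
pieceMap-inverse a U V c≤n c≤n′ k = toℕ-injective
  (piece-unique (pieceMap-piece a U V c≤n _) (piece-flip (pieceMap-piece a V U c≤n′ k)))

shape-exists : ∀ o i → size o + size i + 2 ≡ n → ∃[ ω ] Shape {n} ω o i
shape-exists {n} (a , y) (u , v) eq =
  permutation (pieceMap a U V c≤n) (pieceMap a V U c≤n′)
    (pieceMap-inverse a U V c≤n c≤n′) (pieceMap-inverse a V U c≤n′ c≤n) ,
  shape (trans (sym (size-total a y u v)) eq) (pieceMap-piece a U V c≤n)
  where
  U V : ℕ
  U = suc u
  V = suc v
  c≤n : a + V + U ≤ n
  c≤n = ≤-trans (m≤m+n _ y) (≤-reflexive (trans (sym (size-total a y u v)) eq))
  c≤n′ : a + U + V ≤ n
  c≤n′ = ≤-trans (≤-reflexive (xy∙z≈xz∙y a U V)) c≤n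

-- Bruhat order

⟨$⟩ʳ-injective : ∀ (ω : Permutation′ n) {i j} → ω ⟨$⟩ʳ i ≡ ω ⟨$⟩ʳ j → i ≡ j
⟨$⟩ʳ-injective ω eq = trans (sym (inverseˡ ω)) (trans (cong (ω ⟨$⟩ˡ_) eq) (inverseˡ ω))

transpose-at-i : ∀ (i j : Fin n) → transpose i j ⟨$⟩ʳ i ≡ j
transpose-at-i i j with i ≟ i
... | yes _  = refl
... | no i≢i = contradiction refl i≢i

transpose-at-j : ∀ (i j : Fin n) → transpose i j ⟨$⟩ʳ j ≡ i
transpose-at-j i j with j ≟ i
... | yes j≡i = j≡i
... | no _ with j ≟ j
...   | yes _  = refl
...   | no j≢j = contradiction refl j≢j

transpose-elsewhere : ∀ {i j k : Fin n} → k ≢ i → k ≢ j → transpose i j ⟨$⟩ʳ k ≡ k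
transpose-elsewhere {i = i} {j} {k} k≢i k≢j with k ≟ i
... | yes k≡i = contradiction k≡i k≢i
... | no _ with k ≟ j
...   | yes k≡j = contradiction k≡j k≢j
...   | no _    = refl

-- The graph of `π` differs from that of `σ` only in two points, so an invariant has to be checked
-- only there.
reduction-preserves : ∀ (σ π : Permutation′ n) (P : Fin n → Fin n → Set) → ((i , j , _) : Reduction σ π) →
  P i (σ ⟨$⟩ʳ j) → P j (σ ⟨$⟩ʳ i) → (∀ k → P k (σ ⟨$⟩ʳ k)) → ∀ k → P k (π ⟨$⟩ʳ k)
reduction-preserves σ π P (i , j , _ , _ , eq) Pi Pj Pσ k with k ≟ i | k ≟ j
... | yes refl | _ = subst (P k) (sym (trans (eq k) (cong (σ ⟨$⟩ʳ_) (transpose-at-i i j)))) Pi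
... | no _ | yes refl = subst (P k) (sym (trans (eq k) (cong (σ ⟨$⟩ʳ_) (transpose-at-j i j)))) Pj
... | no k≢i | no k≢j = subst (P k) (sym (trans (eq k) (cong (σ ⟨$⟩ʳ_) (transpose-elsewhere k≢i k≢j)))) (Pσ k)

≤ᴮ-preserves : ∀ (P : Fin n → Fin n → Set) →
  (∀ σ π → Reduction σ π → (∀ k → P k (σ ⟨$⟩ʳ k)) → ∀ k → P k (π ⟨$⟩ʳ k)) →
  ∀ σ π → π ≤ᴮ σ → (∀ k → P k (σ ⟨$⟩ʳ k)) → ∀ k → P k (π ⟨$⟩ʳ k)
≤ᴮ-preserves P step σ π (ρ , path , ρ≈π) Pσ k = subst (P k) (ρ≈π k) (go σ ρ path Pσ k)
  where
  go : ∀ σ ρ → Star Reduction σ ρ → (∀ k → P k (σ ⟨$⟩ʳ k)) → ∀ k → P k (ρ ⟨$⟩ʳ k)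
  go σ ρ ε          Pσ = Pσ
  go σ ρ (_◅_ {j = τ} r path) Pσ = go τ ρ path (step σ τ r Pσ)

module _ (π σ : Permutation′ n) (π≤σ : π ≤ᴮ σ) where

  -- Position `i` receives a smaller value than before, and the value of `i` moves right to `j`;
  -- neither displacement exceeds the old one of `i`.
  raise-bound : ∀ d → (∀ k → toℕ (σ ⟨$⟩ʳ k) ≤ toℕ k + d) → ∀ k → toℕ (π ⟨$⟩ʳ k) ≤ toℕ k + d
  raise-bound d = ≤ᴮ-preserves P
    (λ σ π r@(i , j , i<j , d , _) Pσ → reduction-preserves σ π P r
      (≤-trans (<⇒≤ d) (Pσ i)) (≤-trans (Pσ i) (+-monoˡ-≤ _ (<⇒≤ i<j))) Pσ)
    σ π π≤σ
    where
    P : Fin n → Fin n → Set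
    P k l = toℕ l ≤ toℕ k + d

  lower-bound : ∀ d → (∀ k → toℕ k ≤ toℕ (σ ⟨$⟩ʳ k) + d) → ∀ k → toℕ k ≤ toℕ (π ⟨$⟩ʳ k) + d
  lower-bound d = ≤ᴮ-preserves P
    (λ σ π r@(i , j , i<j , d , _) Pσ → reduction-preserves σ π P r
      (≤-trans (<⇒≤ i<j) (Pσ j)) (≤-trans (Pσ j) (+-monoˡ-≤ _ (<⇒≤ d))) Pσ)
    σ π π≤σ
    where
    P : Fin n → Fin n → Set
    P k l = toℕ k ≤ toℕ l + d

  -- A reduction cannot touch a fixed `i` below `a`: the smaller entry `σ ⟨$⟩ʳ j` would be a fixed
  -- point as well, forcing `j < i`.
  fixes-below : ∀ a → (∀ k → toℕ k < a → σ ⟨$⟩ʳ k ≡ k) → ∀ k → toℕ k < a → π ⟨$⟩ʳ k ≡ k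
  fixes-below a = ≤ᴮ-preserves P step σ π π≤σ
    where
    P : Fin n → Fin n → Set
    P k l = toℕ k < a → l ≡ k
    step : ∀ σ π → Reduction σ π → (∀ k → P k (σ ⟨$⟩ʳ k)) → ∀ k → P k (π ⟨$⟩ʳ k)
    step σ π r@(i , j , i<j , σj<σi , _) Pσ = reduction-preserves σ π P r
      (λ i<a → contradiction i<a i≮a) (λ j<a → contradiction (<-trans i<j j<a) i≮a) Pσ
      where
      i≮a : ¬ toℕ i < a
      i≮a i<a = <-asym i<j (subst (Fin._< i) σj≡j σj<i)
        where
        σj<i : σ ⟨$⟩ʳ j Fin.< i
        σj<i = subst (σ ⟨$⟩ʳ j Fin.<_) (Pσ i i<a) σj<σi
        σj≡j : σ ⟨$⟩ʳ j ≡ j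
        σj≡j = ⟨$⟩ʳ-injective σ (Pσ _ (<-trans σj<i i<a))

  -- Mirror image of `fixes-below`: for a fixed `j` from `c` on, the larger entry `σ ⟨$⟩ʳ i` would
  -- be a fixed point too, again forcing `j < i`.
  fixes-above : ∀ c → (∀ k → c ≤ toℕ k → σ ⟨$⟩ʳ k ≡ k) → ∀ k → c ≤ toℕ k → π ⟨$⟩ʳ k ≡ k
  fixes-above c = ≤ᴮ-preserves P step σ π π≤σ
    where
    P : Fin n → Fin n → Set
    P k l = c ≤ toℕ k → l ≡ k
    step : ∀ σ π → Reduction σ π → (∀ k → P k (σ ⟨$⟩ʳ k)) → ∀ k → P k (π ⟨$⟩ʳ k)
    step σ π r@(i , j , i<j , σj<σi , _) Pσ = reduction-preserves σ π P r
      (λ c≤i → contradiction (≤-trans c≤i (<⇒≤ i<j)) c≰j) (λ c≤j → contradiction c≤j c≰j) Pσ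
      where
      c≰j : ¬ c ≤ toℕ j
      c≰j c≤j = <-asym i<j (subst (j Fin.<_) σi≡i j<σi)
        where
        j<σi : j Fin.< σ ⟨$⟩ʳ i
        j<σi = subst (Fin._< σ ⟨$⟩ʳ i) (Pσ j c≤j) σj<σi
        σi≡i : σ ⟨$⟩ʳ i ≡ i
        σi≡i = ⟨$⟩ʳ-injective σ (Pσ _ (≤-trans c≤j (<⇒≤ j<σi)))

-- Bruhat order implies the order of pairs

piece-raise : ∀ {a U V k l} → Piece a U V k l → l ≤ k + U
piece-raise (fixedˡ _ refl)   = m≤m+n _ _
piece-raise (raised _ _ refl) = ≤-refl
piece-raise (lowered _ _ refl) = ≤-trans (m≤m+n _ _) (m≤m+n _ _)
piece-raise (fixedʳ _ refl)   = m≤m+n _ _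

piece-lower : ∀ {a U V k l} → Piece a U V k l → k ≤ l + V
piece-lower p = piece-raise (piece-flip p)

-- The invariants of `σ` are tested where `π` exhausts its own: position `a` is raised by exactly
-- `U`, position `a + V` is lowered by exactly `V`, and the extreme positions `a` and `a + V + u` of
-- the middle blocks are not fixed.
≤ᴮ⇒≤² : ∀ {π σ : Permutation′ n} {o i o′ i′} → Shape π o i → Shape σ o′ i′ → π ≤ᴮ σ → o′ ≤² o × i ≤² i′
≤ᴮ⇒≤² {n} {π} {σ} {a , y} {u , v} {a′ , y′} {u′ , v′} s s′ π≤σ = (a′≤a , y′≤y) , (s≤s⁻¹ U≤U′ , s≤s⁻¹ V≤V′)
  where
  U V U′ V′ : ℕ
  U  = suc u
  V  = suc v
  U′ = suc u′
  V′ = suc v′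
  b<c : a + V < a + V + U
  b<c = m<m+n (a + V) (s≤s z≤n)
  a<b : a < a + V
  a<b = m<m+n a (s≤s z≤n)
  b≤c-1 : a + V ≤ a + V + u
  b≤c-1 = m≤m+n (a + V) u
  c-1<c : a + V + u < a + V + U
  c-1<c = +-monoʳ-< (a + V) (n<1+n u)
  at-a : ∃[ i ] toℕ {n} i ≡ a
  at-a = at (<-trans a<b (<-≤-trans b<c (end≤n s)))
  at-b : ∃[ i ] toℕ {n} i ≡ a + V
  at-b = at (<-≤-trans b<c (end≤n s))
  at-c-1 : ∃[ i ] toℕ {n} i ≡ a + V + u
  at-c-1 = at (<-≤-trans c-1<c (end≤n s))
  πa : toℕ (π ⟨$⟩ʳ proj₁ at-a) ≡ a + U
  πa = value s _ (proj₂ at-a) (raised ≤-refl a<b refl)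
  πb : toℕ (π ⟨$⟩ʳ proj₁ at-b) ≡ a
  πb = value s _ (proj₂ at-b) (lowered ≤-refl b<c refl)
  πc-1 : toℕ (π ⟨$⟩ʳ proj₁ at-c-1) + V ≡ a + V + u
  πc-1 = trans (cong (_+ V) (value s _ (proj₂ at-c-1) (lowered b≤c-1 c-1<c (xy∙z≈xz∙y a u V)))) (xy∙z≈xz∙y a u V)
  U≤U′ : U ≤ U′
  U≤U′ = +-cancelˡ-≤ a U U′ (subst₂ (λ k l → l ≤ k + U′) (proj₂ at-a) πa
    (raise-bound π σ π≤σ U′ (λ k → piece-raise (piece s′ k)) (proj₁ at-a)))
  V≤V′ : V ≤ V′
  V≤V′ = +-cancelˡ-≤ a V V′ (subst₂ (λ k l → k ≤ l + V′) (proj₂ at-b) πb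
    (lower-bound π σ π≤σ V′ (λ k → piece-lower (piece s′ k)) (proj₁ at-b)))
  a′≤a : a′ ≤ a
  a′≤a = ≮⇒≥ λ a<a′ → <⇒≢ (m<m+n a {U} (s≤s z≤n)) (trans (sym (proj₂ at-a)) (trans
    (sym (cong toℕ (fixes-below π σ π≤σ a′ (λ k k<a′ → toℕ-injective (value s′ k refl (fixedˡ k<a′ refl)))
      (proj₁ at-a) (subst (_< a′) (sym (proj₂ at-a)) a<a′))))
    πa))
  c≤c′ : a + V + U ≤ a′ + V′ + U′
  c≤c′ = ≮⇒≥ λ c′<c → <⇒≢ (m<m+n (a + V + u) {V} (s≤s z≤n)) (trans (sym πc-1) (cong (_+ V) (trans
    (cong toℕ (fixes-above π σ π≤σ (a′ + V′ + U′) (λ k c′≤k → toℕ-injective (value s′ k refl (fixedʳ c′≤k refl)))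
      (proj₁ at-c-1) (subst (a′ + V′ + U′ ≤_) (sym (proj₂ at-c-1)) (s≤s⁻¹ (≤-trans c′<c (≤-reflexive (+-suc (a + V) u)))))))
    (proj₂ at-c-1))))
  -- Both totals are `n`, so the ends of the middle blocks and the lengths of the final blocks
  -- compare in opposite directions.
  y′≤y : y′ ≤ y
  y′≤y = +-cancelˡ-≤ (a + V + U) y′ y (≤-trans (+-monoˡ-≤ y′ c≤c′)
    (≤-reflexive (trans (total s′) (sym (total s)))))

-- Bruhat order is a preorder invariant under inversion

≤ᴮ-reflexive : ∀ {π σ : Permutation′ n} → σ ≈ π → π ≤ᴮ σ
≤ᴮ-reflexive {σ = σ} eq = σ , ε , eq

-- The path from `σ` ends in `ρ′`, only pointwise equal to `ρ`. It suffices to restart the first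
-- reduction of the other path at `ρ′`; the rest of that path is unchanged.
≤ᴮ-trans : ∀ {π ρ σ : Permutation′ n} → π ≤ᴮ ρ → ρ ≤ᴮ σ → π ≤ᴮ σ
≤ᴮ-trans (π′ , ε , π′≈π) (ρ′ , path , ρ′≈ρ) = ρ′ , path , λ k → trans (ρ′≈ρ k) (π′≈π k)
≤ᴮ-trans (π′ , (i , j , i<j , d , eq) ◅ path , π′≈π) (ρ′ , path′ , ρ′≈ρ) =
  π′ , path′ ◅◅ (i , j , i<j , subst₂ Fin._<_ (sym (ρ′≈ρ j)) (sym (ρ′≈ρ i)) d ,
                  λ k → trans (eq k) (sym (ρ′≈ρ _))) ◅ path , π′≈π

flip-cong : ∀ {π σ : Permutation′ n} → π ≈ σ → flip π ≈ flip σ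
flip-cong {π = π} {σ} eq k = ⟨$⟩ʳ-injective σ (trans (sym (eq _)) (trans (inverseʳ π) (sym (inverseʳ σ))))

-- An inversion of `σ` at positions `i < j` is one of its inverse at positions
-- `σ ⟨$⟩ʳ j < σ ⟨$⟩ʳ i`, and interchanging two entries exchanges the positions of these two values.
reduction-flip : ∀ {π σ : Permutation′ n} → Reduction σ π → Reduction (flip σ) (flip π)
reduction-flip {n} {π} {σ} (i , j , i<j , d , eq) =
  σ ⟨$⟩ʳ j , σ ⟨$⟩ʳ i , d , subst₂ Fin._<_ (sym (inverseˡ σ)) (sym (inverseˡ σ)) i<j , flip-eq
  where
  flip-eq : ∀ k → flip π ⟨$⟩ʳ k ≡ (transpose (σ ⟨$⟩ʳ j) (σ ⟨$⟩ʳ i) ∘ₚ flip σ) ⟨$⟩ʳ k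
  flip-eq k = ⟨$⟩ʳ-injective π (trans (inverseʳ π) (sym (trans (eq _) (σ-transpose k (k ≟ _) (k ≟ _)))))
    where
    σ-transpose : ∀ k → Dec (k ≡ σ ⟨$⟩ʳ j) → Dec (k ≡ σ ⟨$⟩ʳ i) →
      σ ⟨$⟩ʳ (transpose i j ⟨$⟩ʳ (σ ⟨$⟩ˡ (transpose (σ ⟨$⟩ʳ j) (σ ⟨$⟩ʳ i) ⟨$⟩ʳ k))) ≡ k
    σ-transpose k (yes refl) _ = trans (cong (λ x → σ ⟨$⟩ʳ (transpose i j ⟨$⟩ʳ x))
                           (trans (cong (σ ⟨$⟩ˡ_) (transpose-at-i (σ ⟨$⟩ʳ j) (σ ⟨$⟩ʳ i))) (inverseˡ σ)))
                           (cong (σ ⟨$⟩ʳ_) (transpose-at-i i j))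
    σ-transpose k (no _) (yes refl) = trans (cong (λ x → σ ⟨$⟩ʳ (transpose i j ⟨$⟩ʳ x))
                           (trans (cong (σ ⟨$⟩ˡ_) (transpose-at-j (σ ⟨$⟩ʳ j) (σ ⟨$⟩ʳ i))) (inverseˡ σ)))
                           (cong (σ ⟨$⟩ʳ_) (transpose-at-j i j))
    σ-transpose k (no k≢σj) (no k≢σi) = trans
      (cong (λ x → σ ⟨$⟩ʳ (transpose i j ⟨$⟩ʳ (σ ⟨$⟩ˡ x))) (transpose-elsewhere k≢σj k≢σi))
      (trans (cong (σ ⟨$⟩ʳ_) (transpose-elsewhere
        (λ eq → k≢σi (trans (sym (inverseʳ σ)) (cong (σ ⟨$⟩ʳ_) eq)))
        (λ eq → k≢σj (trans (sym (inverseʳ σ)) (cong (σ ⟨$⟩ʳ_) eq))))) (inverseʳ σ))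

≤ᴮ-flip : ∀ {π σ : Permutation′ n} → π ≤ᴮ σ → flip π ≤ᴮ flip σ
≤ᴮ-flip {π = π} (ρ , path , ρ≈π) =
  flip ρ , gmap flip (λ {x} {y} → reduction-flip {π = y} {x}) path , flip-cong {π = ρ} {π} ρ≈π

-- Cyclic shifts of consecutive entries as products of reductions

record MovedLeft (σ : Permutation′ n) (p : ℕ) (q : Fin n) (ρ : Permutation′ n) : Set where
  constructor movedLeft
  field
    first  : ∀ k → toℕ k ≡ p → ρ ⟨$⟩ʳ k ≡ σ ⟨$⟩ʳ q
    middle : ∀ k k′ → p ≤ toℕ k → k Fin.< q → toℕ k′ ≡ suc (toℕ k) → ρ ⟨$⟩ʳ k′ ≡ σ ⟨$⟩ʳ k
    rest   : ∀ k → toℕ k < p ⊎ q Fin.< k → ρ ⟨$⟩ʳ k ≡ σ ⟨$⟩ʳ k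

record MovedRight (σ : Permutation′ n) (p q : Fin n) (ρ : Permutation′ n) : Set where
  constructor movedRight
  field
    final  : ρ ⟨$⟩ʳ q ≡ σ ⟨$⟩ʳ p
    middle : ∀ k k′ → p Fin.≤ k → k Fin.< q → toℕ k′ ≡ suc (toℕ k) → ρ ⟨$⟩ʳ k ≡ σ ⟨$⟩ʳ k′
    rest   : ∀ k → k Fin.< p ⊎ q Fin.< k → ρ ⟨$⟩ʳ k ≡ σ ⟨$⟩ʳ k

-- The entry at `q` travels left by interchanges of neighbours, which are reductions because it is
-- smaller than every entry it passes.
moveLeft : ∀ m (σ : Permutation′ n) (p : ℕ) (q : Fin n) → toℕ q ≡ p + m →
  (∀ k → p ≤ toℕ k → k Fin.< q → σ ⟨$⟩ʳ q Fin.< σ ⟨$⟩ʳ k) →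
  ∃[ ρ ] Star Reduction σ ρ × MovedLeft σ p q ρ
moveLeft zero σ p q q≡ larger = σ , ε , movedLeft
  (λ k k≡p → cong (σ ⟨$⟩ʳ_) (toℕ-injective (trans k≡p (sym (trans q≡ (+-identityʳ p))))))
  (λ k k′ p≤k k<q _ → contradiction (≤-trans (≤-reflexive (trans q≡ (+-identityʳ p))) p≤k) (<⇒≱ k<q))
  (λ _ _ → refl)
moveLeft {n} (suc m) σ p q q≡ larger
  with (q′ , q′≡) ← at (≤-<-trans (n≤1+n (p + m)) (subst (_< n) (trans q≡ (+-suc p m)) (toℕ<n q)))
  with moveLeft m (transpose q′ q ∘ₚ σ) p q′ q′≡ (λ k p≤k k<q′ → subst₂ Fin._<_
        (cong (σ ⟨$⟩ʳ_) (sym (transpose-at-i q′ q)))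
        (cong (σ ⟨$⟩ʳ_) (sym (transpose-elsewhere (λ { refl → <-irrefl refl k<q′ })
                                                   (λ { refl → <-asym k<q′ (q′<q q′≡) }))))
        (larger k p≤k (<-trans k<q′ (q′<q q′≡))))
  where
  q′<q : ∀ {q′ : Fin n} → toℕ q′ ≡ p + m → q′ Fin.< q
  q′<q q′≡ = ≤-reflexive (trans (cong suc q′≡) (sym (trans q≡ (+-suc p m))))
... | ρ , path , movedLeft first middle rest =
  ρ , (q′ , q , q′<q , larger q′ (subst (p ≤_) (sym q′≡) (m≤m+n p m)) q′<q , λ _ → refl) ◅ path , movedLeft
  (λ k k≡p → trans (first k k≡p) (cong (σ ⟨$⟩ʳ_) (transpose-at-i q′ q)))
  middle′
  (λ k o → trans (rest k (weaken o)) (cong (σ ⟨$⟩ʳ_) (transpose-elsewhere (≢q′ o) (≢q o))))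
  where
  1+q′≡q : suc (toℕ q′) ≡ toℕ q
  1+q′≡q = trans (cong suc q′≡) (sym (trans q≡ (+-suc p m)))
  q′<q : q′ Fin.< q
  q′<q = ≤-reflexive 1+q′≡q
  weaken : ∀ {k} → toℕ k < p ⊎ q Fin.< k → toℕ k < p ⊎ q′ Fin.< k
  weaken (inj₁ k<p) = inj₁ k<p
  weaken (inj₂ q<k) = inj₂ (<-trans q′<q q<k)
  ≢q′ : ∀ {k} → toℕ k < p ⊎ q Fin.< k → k ≢ q′
  ≢q′ (inj₁ k<p) refl = contradiction (≤-trans (m≤m+n p m) (≤-reflexive (sym q′≡))) (<⇒≱ k<p)
  ≢q′ (inj₂ q<k) refl = <-asym q<k q′<q
  ≢q : ∀ {k} → toℕ k < p ⊎ q Fin.< k → k ≢ q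
  ≢q (inj₁ k<p) refl = contradiction (≤-trans (m≤m+n p (suc m)) (≤-reflexive (sym q≡))) (<⇒≱ k<p)
  ≢q (inj₂ q<k) refl = <-irrefl refl q<k
  middle′ : ∀ k k′ → p ≤ toℕ k → k Fin.< q → toℕ k′ ≡ suc (toℕ k) → ρ ⟨$⟩ʳ k′ ≡ σ ⟨$⟩ʳ k
  middle′ k k′ p≤k k<q k′≡ with m≤n⇒m<n∨m≡n (s≤s⁻¹ (≤-trans k<q (≤-reflexive (sym 1+q′≡q))))
  ... | inj₁ k<q′ = trans (middle k k′ p≤k k<q′ k′≡)
        (cong (σ ⟨$⟩ʳ_) (transpose-elsewhere (λ { refl → <-irrefl refl k<q′ }) (λ { refl → <-irrefl refl k<q })))
  -- The entry of `q′` went to `q` in the first interchange, and the later ones stay to the left of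
  -- `q`.
  ... | inj₂ k≡q′ with refl ← toℕ-injective k≡q′
                        with refl ← toℕ-injective (trans k′≡ 1+q′≡q) =
        trans (rest q (inj₂ q′<q)) (cong (σ ⟨$⟩ʳ_) (transpose-at-j q′ q))

-- Here the left end of the range advances: after the first interchange the travelling entry stands
-- at `p′` and still exceeds all entries up to `q`.
moveRight : ∀ m (σ : Permutation′ n) (p q : Fin n) → toℕ q ≡ toℕ p + m →
  (∀ k → p Fin.< k → k Fin.≤ q → σ ⟨$⟩ʳ k Fin.< σ ⟨$⟩ʳ p) →
  ∃[ ρ ] Star Reduction σ ρ × MovedRight σ p q ρ
moveRight zero σ p q q≡ smaller with refl ← toℕ-injective (trans q≡ (+-identityʳ _)) =
  σ , ε , movedRight refl (λ k k′ p≤k k<q _ → contradiction p≤k (<⇒≱ k<q)) (λ _ _ → refl)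
moveRight {n} (suc m) σ p q q≡ smaller
  with (p′ , p′≡) ← at (≤-<-trans (s≤s (m≤m+n (toℕ p) m)) (subst (_< n) (trans q≡ (+-suc (toℕ p) m)) (toℕ<n q)))
  with moveRight m (transpose p p′ ∘ₚ σ) p′ q (trans q≡ (trans (+-suc (toℕ p) m) (cong (_+ m) (sym p′≡))))
        (λ k p′<k k≤q → subst₂ Fin._<_
          (cong (σ ⟨$⟩ʳ_) (sym (transpose-elsewhere (λ { refl → <-asym p′<k (p<p′ p′≡) })
                                                     (λ { refl → <-irrefl refl p′<k }))))
          (cong (σ ⟨$⟩ʳ_) (sym (transpose-at-j p p′)))
          (smaller k (<-trans (p<p′ p′≡) p′<k) k≤q))
  where
  p<p′ : ∀ {p′ : Fin n} → toℕ p′ ≡ suc (toℕ p) → p Fin.< p′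
  p<p′ p′≡ = ≤-reflexive (sym p′≡)
... | ρ , path , movedRight final middle rest =
  ρ , (p , p′ , p<p′ , smaller p′ p<p′ p′≤q , λ _ → refl) ◅ path , movedRight
  (trans final (cong (σ ⟨$⟩ʳ_) (transpose-at-j p p′)))
  middle′
  (λ k o → trans (rest k (weaken o)) (cong (σ ⟨$⟩ʳ_) (transpose-elsewhere (≢p o) (≢p′ o))))
  where
  p<p′ : p Fin.< p′
  p<p′ = ≤-reflexive (sym p′≡)
  p′≤q : p′ Fin.≤ q
  p′≤q = ≤-trans (≤-trans (≤-reflexive p′≡) (s≤s (m≤m+n (toℕ p) m))) (≤-reflexive (sym (trans q≡ (+-suc (toℕ p) m))))
  weaken : ∀ {k} → k Fin.< p ⊎ q Fin.< k → k Fin.< p′ ⊎ q Fin.< k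
  weaken (inj₁ k<p) = inj₁ (<-trans k<p p<p′)
  weaken (inj₂ q<k) = inj₂ q<k
  ≢p : ∀ {k} → k Fin.< p ⊎ q Fin.< k → k ≢ p
  ≢p (inj₁ k<p) refl = <-irrefl refl k<p
  ≢p (inj₂ q<k) refl = contradiction q<k (≤⇒≯ (<⇒≤ (<-≤-trans p<p′ p′≤q)))
  ≢p′ : ∀ {k} → k Fin.< p ⊎ q Fin.< k → k ≢ p′
  ≢p′ (inj₁ k<p) refl = <-asym k<p p<p′
  ≢p′ (inj₂ q<k) refl = contradiction q<k (≤⇒≯ p′≤q)
  middle′ : ∀ k k′ → p Fin.≤ k → k Fin.< q → toℕ k′ ≡ suc (toℕ k) → ρ ⟨$⟩ʳ k ≡ σ ⟨$⟩ʳ k′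
  middle′ k k′ p≤k k<q k′≡ with m≤n⇒m<n∨m≡n p≤k
  ... | inj₁ p<k = trans (middle k k′ (≤-trans (≤-reflexive p′≡) p<k) k<q k′≡)
        (cong (σ ⟨$⟩ʳ_) (transpose-elsewhere
          (λ { refl → <-irrefl refl (<-trans p<k (≤-reflexive (sym k′≡))) })
          (λ { refl → <-irrefl refl (subst (_< toℕ k) (suc-injective (trans (sym p′≡) k′≡)) p<k) })))
  ... | inj₂ p≡k with refl ← toℕ-injective p≡k with refl ← toℕ-injective (trans k′≡ (sym p′≡)) =
        trans (rest p (inj₁ p<p′)) (cong (σ ⟨$⟩ʳ_) (transpose-at-i p p′))

-- The first lowered entry, of value `a`, passes the raised block and becomes a fixed point at `a`.
-- The raised entries, now one place further right, are raised by one less.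
movedLeft-≈ : ∀ {π σ ρ : Permutation′ n} {a y u v q} →
  Shape π (suc a , y) (u , v) → Shape σ (a , y) (suc u , v) →
  toℕ q ≡ a + suc v → MovedLeft σ a q ρ → ρ ≈ π
movedLeft-≈ {n} {π} {σ} {ρ} {a} {y} {u} {v} {q} s t q≡ (movedLeft first middle rest) k = toℕ-injective (values k)
  where
  values : ∀ k → toℕ (ρ ⟨$⟩ʳ k) ≡ toℕ (π ⟨$⟩ʳ k)
  values k with piece s k
  ... | fixedˡ k<1+a πk with m≤n⇒m<n∨m≡n (s≤s⁻¹ k<1+a)
  ...   | inj₁ k<a = trans (cong toℕ (rest k (inj₁ k<a))) (trans (value t k refl (fixedˡ k<a refl)) (sym πk))
  ...   | inj₂ k≡a = trans (cong toℕ (first k k≡a)) 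
          (trans (value t q q≡ (lowered ≤-refl (m<m+n (a + suc v) (s≤s z≤n)) refl)) (trans (sym k≡a) (sym πk)))
  values k | raised 1+a≤k k<b πk = earlier (toℕ k) refl 1+a≤k k<b
    where
    -- The entry at `k` comes from the place before it; matching on the number of `k` exposes that
    -- place.
    earlier : ∀ x → toℕ k ≡ x → suc a ≤ x → x < suc (a + suc v) → toℕ (ρ ⟨$⟩ʳ k) ≡ toℕ (π ⟨$⟩ʳ k)
    earlier (suc x) k≡ (s≤s a≤x) (s≤s x<b)
      with (k′ , k′≡) ← at {n} (<-trans (n<1+n x) (subst (_< n) k≡ (toℕ<n k))) =
        trans (cong toℕ (middle k′ k (subst (a ≤_) (sym k′≡) a≤x)
                           (subst₂ _<_ (sym k′≡) (sym q≡) x<b) (trans k≡ (cong suc (sym k′≡)))))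
        (trans (value t k′ k′≡ (raised a≤x x<b refl))
        (trans (+-suc x (suc u)) (trans (cong (_+ suc u) (sym k≡)) (sym πk))))
  values k | lowered b<k k<c πk = trans (cong toℕ (rest k (inj₂ (subst (_< toℕ k) (sym q≡) b<k))))
    (value t k refl (lowered (<⇒≤ b<k) (≤-trans k<c (≤-reflexive (sym (+-suc (a + suc v) (suc u))))) πk))
  values k | fixedʳ c≤k πk = trans (cong toℕ (rest k (inj₂ (subst (_< toℕ k) (sym q≡) (≤-trans (m≤m+n _ _) c≤k)))))
    (value t k refl (fixedʳ (≤-trans (≤-reflexive (+-suc (a + suc v) (suc u))) c≤k) πk))

shape-≤-moveLeft : ∀ {π σ : Permutation′ n} {a y u v} →
  Shape π (suc a , y) (u , v) → Shape σ (a , y) (suc u , v) → π ≤ᴮ σ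
shape-≤-moveLeft {n} {π} {σ} {a} {y} {u} {v} s t =
  let ρ , path , moved = moveLeft V σ a q q≡ larger in ρ , path , movedLeft-≈ s t q≡ moved
  where
  V : ℕ
  V = suc v
  at-b : ∃[ q ] toℕ {n} q ≡ a + V
  at-b = at (<-≤-trans (m<m+n (a + V) (s≤s z≤n)) (end≤n t))
  q : Fin n
  q = proj₁ at-b
  q≡ : toℕ q ≡ a + V
  q≡ = proj₂ at-b
  σq : toℕ (σ ⟨$⟩ʳ q) ≡ a
  σq = value t q q≡ (lowered ≤-refl (m<m+n (a + V) (s≤s z≤n)) refl)
  σ-raised : ∀ k → a ≤ toℕ k → toℕ k < a + V → toℕ (σ ⟨$⟩ʳ k) ≡ toℕ k + suc (suc u)
  σ-raised k a≤k k<b = value t k refl (raised a≤k k<b refl)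
  larger : ∀ k → a ≤ toℕ k → k Fin.< q → σ ⟨$⟩ʳ q Fin.< σ ⟨$⟩ʳ k
  larger k a≤k k<q = subst₂ _<_ (sym σq) (sym (σ-raised k a≤k (subst (toℕ k <_) q≡ k<q)))
    (≤-<-trans a≤k (m<m+n (toℕ k) (s≤s z≤n)))

-- The last raised entry, at `p`, has the value of position `q`, the end of the lowered block, and
-- becomes fixed there. The lowered entries move one place left and are lowered by one less.
movedRight-≈ : ∀ {π σ ρ : Permutation′ n} {a y u v p q} →
  Shape π (a , suc y) (u , v) → Shape σ (a , y) (u , suc v) →
  toℕ p ≡ a + suc v → toℕ q ≡ a + suc v + suc u → MovedRight σ p q ρ → ρ ≈ π
movedRight-≈ {n} {π} {σ} {ρ} {a} {y} {u} {v} {p} {q} s t p≡ q≡ (movedRight final middle rest) k = toℕ-injective (values k)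
  where
  U V : ℕ
  U = suc u
  V = suc v
  b+U≡ : a + suc V + U ≡ suc (a + V + U)
  b+U≡ = cong (_+ U) (+-suc a V)
  c<n : a + V + U < n
  c<n = subst (_≤ n) b+U≡ (end≤n t)
  values : ∀ k → toℕ (ρ ⟨$⟩ʳ k) ≡ toℕ (π ⟨$⟩ʳ k)
  values k with piece s k
  ... | fixedˡ k<a πk = trans (cong toℕ (rest k (inj₁ (<-≤-trans k<a (≤-trans (m≤m+n a V) (≤-reflexive (sym p≡)))))))
        (trans (value t k refl (fixedˡ k<a refl)) (sym πk))
  ... | raised a≤k k<b πk = trans (cong toℕ (rest k (inj₁ (<-≤-trans k<b (≤-reflexive (sym p≡))))))
        (trans (value t k refl (raised a≤k (<-trans k<b (+-monoʳ-< a (n<1+n V))) refl)) (sym πk))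
  ... | lowered b≤k k<c πk with (k′ , k′≡) ← at (≤-<-trans k<c c<n) =
        trans (cong toℕ (middle k k′ (≤-trans (≤-reflexive p≡) b≤k) (<-≤-trans k<c (≤-reflexive (sym q≡))) k′≡))
        (value t k′ k′≡ (lowered (≤-trans (≤-reflexive (+-suc a V)) (s≤s b≤k))
          (≤-trans (s≤s k<c) (≤-reflexive (sym b+U≡))) (trans (+-suc _ V) (cong suc πk))))
  ... | fixedʳ c≤k πk with m≤n⇒m<n∨m≡n c≤k
  ...   | inj₁ c<k = trans (cong toℕ (rest k (inj₂ (≤-<-trans (≤-reflexive q≡) c<k))))
          (trans (value t k refl (fixedʳ (≤-trans (≤-reflexive b+U≡) c<k) refl)) (sym πk))
  ...   | inj₂ c≡k with refl ← toℕ-injective (trans q≡ c≡k) =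
          trans (cong toℕ final)
            (trans (value t p p≡ (raised (m≤m+n a V) (+-monoʳ-< a (n<1+n V)) refl)) (trans c≡k (sym πk)))

shape-≤-moveRight : ∀ {π σ : Permutation′ n} {a y u v} →
  Shape π (a , suc y) (u , v) → Shape σ (a , y) (u , suc v) → π ≤ᴮ σ
shape-≤-moveRight {n} {π} {σ} {a} {y} {u} {v} s t =
  let ρ , path , moved = moveRight U σ p q (trans q≡ (cong (_+ U) (sym p≡))) smaller
  in ρ , path , movedRight-≈ s t p≡ q≡ moved
  where
  U V : ℕ
  U = suc u
  V = suc v
  b+U≡ : a + suc V + U ≡ suc (a + V + U)
  b+U≡ = cong (_+ U) (+-suc a V)
  c<n : a + V + U < n
  c<n = subst (_≤ n) b+U≡ (end≤n t)
  p q : Fin n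
  p = proj₁ (at (≤-<-trans (m≤m+n (a + V) U) c<n))
  q = proj₁ (at c<n)
  p≡ : toℕ p ≡ a + V
  p≡ = proj₂ (at (≤-<-trans (m≤m+n (a + V) U) c<n))
  q≡ : toℕ q ≡ a + V + U
  q≡ = proj₂ (at c<n)
  σp : toℕ (σ ⟨$⟩ʳ p) ≡ a + V + U
  σp = value t p p≡ (raised (m≤m+n a V) (+-monoʳ-< a (n<1+n V)) refl)
  smaller : ∀ k → p Fin.< k → k Fin.≤ q → σ ⟨$⟩ʳ k Fin.< σ ⟨$⟩ʳ p
  smaller k p<k k≤q with piece t k
  ... | fixedˡ k<a _ = contradiction (≤-trans (m≤m+n a V) (≤-trans (≤-reflexive (sym p≡)) (<⇒≤ p<k))) (<⇒≱ k<a)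
  ... | raised _ k<b _ = contradiction k<b (≤⇒≯ (≤-trans (≤-reflexive (trans (+-suc a V) (cong suc (sym p≡)))) p<k))
  ... | lowered _ _ σk = ≤-trans (m<m+n _ (s≤s z≤n))
                (≤-trans (≤-reflexive σk) (≤-trans k≤q (≤-reflexive (trans q≡ (sym σp)))))
  ... | fixedʳ c≤k _ = contradiction (≤-trans (≤-reflexive (sym b+U≡)) c≤k) (≤⇒≯ (≤-trans k≤q (≤-reflexive q≡)))

-- Equal letters are shifts of positions. Inversion keeps the outer pair and swaps the inner
-- coordinates, so unequal letters are shifts of values.
shape-≤-step : ∀ β γ {π σ : Permutation′ n} {o i} → Shape π (bump β o) i → Shape σ o (bump γ i) → π ≤ᴮ σ
shape-≤-step true  true  s t = shape-≤-moveLeft s t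
shape-≤-step true  false {π} {σ} s t =
  ≤ᴮ-flip {π = flip π} {flip σ} (shape-≤-moveLeft {π = flip π} {flip σ} (shape-flip s) (shape-flip t))
shape-≤-step false false s t = shape-≤-moveRight s t
shape-≤-step false true  {π} {σ} s t =
  ≤ᴮ-flip {π = flip π} {flip σ} (shape-≤-moveRight {π = flip π} {flip σ} (shape-flip s) (shape-flip t))

shape-size : ∀ {ω : Permutation′ n} {o i} → Shape ω o i → size o + size i + 2 ≡ n
shape-size {o = a , y} {u , v} s = trans (size-total a y u v) (total s)

shape-sizes : ∀ {π σ : Permutation′ n} {o i o′ i′} → Shape π o i → Shape σ o′ i′ → size o + size i ≡ size o′ + size i′
shape-sizes s t = +-cancelʳ-≡ 2 _ _ (trans (shape-size s) (sym (shape-size t)))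

-- Induction on the difference of the inner sizes, through an intermediate permutation one unit
-- above `π`.
≤²⇒≤ᴮ : ∀ {π σ : Permutation′ n} {o i o′ i′} → Shape π o i → Shape σ o′ i′ → o′ ≤² o → i ≤² i′ → π ≤ᴮ σ
≤²⇒≤ᴮ {i = i} {o′} {i′} s t o′≤o i≤i′ = go (size i′ ∸ size i) s t o′≤o i≤i′ (m+[n∸m]≡n (size-mono i≤i′))
  where
  go : ∀ m {π σ : Permutation′ n} {o i o′ i′} → Shape π o i → Shape σ o′ i′ → o′ ≤² o → i ≤² i′ →
    size i + m ≡ size i′ → π ≤ᴮ σ
  -- Equal inner sizes force equal inner pairs, and the common total then forces equal outer pairs.
  go zero {π} {σ} {o} {i} {o′} {i′} s t o′≤o i≤i′ eq
    with refl ← ≤²-size-≡ i≤i′ (trans (sym (+-identityʳ _)) eq)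
    with refl ← ≤²-size-≡ o′≤o (+-cancelʳ-≡ (size i) _ _ (shape-sizes t s)) =
    ≤ᴮ-reflexive {π = π} {σ} (shape-≈ t s)
  go (suc m) {π} {σ} {o} {i} {o′} {i′} s t o′≤o i≤i′ eq
    with i<i′ ← ≤-trans (m<m+n (size i) (s≤s z≤n)) (≤-reflexive eq)
    with o′<o ← +-cancelʳ-< (size i) (size o′) (size o)
                  (<-≤-trans (+-monoʳ-< (size o′) i<i′) (≤-reflexive (sym (shape-sizes s t))))
    with (γ , i₁≤i′) ← ≤²-bump⁺ i≤i′ i<i′
    with (β , o₁ , refl , o′≤o₁) ← ≤²-bump⁻ o′≤o o′<o
    = let ρ , r = shape-exists o₁ (bump γ i) (trans (cong (_+ 2) (size-exchange β o₁ γ i)) (shape-size s)) in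
      ≤ᴮ-trans {π = π} {ρ} {σ} (shape-≤-step β γ s r)
        (go m r t o′≤o₁ i₁≤i′ (trans (cong (_+ m) (size-bump γ i)) (trans (sym (+-suc (size i) m)) eq)))

-- Shapes of bigrassmannian permutations

FixesBelow : Permutation′ n → Fin n → Set
FixesBelow ω a = ∀ k → k Fin.< a → ω ⟨$⟩ʳ k ≡ k

-- A value below `a` is already taken by the position equal to it.
fixesBelow-≤ : ∀ (ω : Permutation′ n) {a} → FixesBelow ω a → ∀ {k} → a Fin.≤ k → a Fin.≤ ω ⟨$⟩ʳ k
fixesBelow-≤ ω fix {k} a≤k = ≮⇒≥ λ ωk<a → <⇒≱ ωk<a (subst (_ Fin.≤_) (sym (⟨$⟩ʳ-injective ω (fix _ ωk<a))) a≤k)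

flip-fixesBelow : ∀ (ω : Permutation′ n) {a} → FixesBelow ω a → FixesBelow (flip ω) a
flip-fixesBelow ω fix k k<a = ⟨$⟩ʳ-injective ω (trans (inverseʳ ω) (sym (fix k k<a)))

flip-moves : ∀ (ω : Permutation′ n) {a} → ω ⟨$⟩ʳ a ≢ a → flip ω ⟨$⟩ʳ a ≢ a
flip-moves ω moves eq = moves (trans (cong (ω ⟨$⟩ʳ_) (sym eq)) (inverseʳ ω))

module _ (ω : Permutation′ n) (one : HasOneDescent ω) where

  private
    p : Fin n
    p = proj₁ one

  ascent : ∀ {i j} → toℕ j ≡ suc (toℕ i) → i ≢ p → ω ⟨$⟩ʳ i Fin.< ω ⟨$⟩ʳ j
  ascent {i} {j} j≡ i≢p = Fin-≤∧≢⇒< (≮⇒≥ λ d → i≢p (sym (proj₂ (proj₂ one) (j , j≡ , d))))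
    λ eq → 1+n≢n (trans (sym j≡) (cong toℕ (⟨$⟩ʳ-injective ω (sym eq))))

  increasing : ∀ {i j} → p Fin.< i → i Fin.< j → ω ⟨$⟩ʳ i Fin.< ω ⟨$⟩ʳ j
  increasing {i} {j} p<i i<j = go (toℕ j ∸ suc (toℕ i)) i p<i (m+[n∸m]≡n i<j)
    where
    go : ∀ m i → p Fin.< i → suc (toℕ i) + m ≡ toℕ j → ω ⟨$⟩ʳ i Fin.< ω ⟨$⟩ʳ j
    go zero i p<i eq = ascent (trans (sym eq) (+-identityʳ _)) (λ { refl → <-irrefl refl p<i })
    go (suc m) i p<i eq =
      let i′ , i′≡ = at (≤-<-trans (≤-trans (m≤m+n (suc (toℕ i)) (suc m)) (≤-reflexive eq)) (toℕ<n j))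
      in <-trans (ascent i′≡ (λ { refl → <-irrefl refl p<i }))
           (go m i′ (<-trans p<i (≤-reflexive (sym i′≡)))
             (trans (cong (λ x → suc x + m) i′≡) (trans (cong suc (sym (+-suc (toℕ i) m))) eq)))

  module _ {a : Fin n} (fix : FixesBelow ω a) (moves : ω ⟨$⟩ʳ a ≢ a) where

    private
      A : Fin n
      A = ω ⟨$⟩ˡ a

    a<ω⁻¹a : a Fin.< A
    a<ω⁻¹a = Fin-≤∧≢⇒< (fixesBelow-≤ (flip ω) (flip-fixesBelow ω fix) ≤-refl)
      λ eq → moves (trans (cong (ω ⟨$⟩ʳ_) eq) (inverseʳ ω))

    -- a is the least value at the positions from a on, so its position ends the descent.
    descent-before-ω⁻¹a : toℕ A ≡ suc (toℕ p)
    descent-before-ω⁻¹a = go (toℕ A) refl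
      where
      go : ∀ x → toℕ A ≡ x → x ≡ suc (toℕ p)
      go zero    A≡ = contradiction (subst (toℕ a <_) A≡ a<ω⁻¹a) n≮0
      go (suc x) A≡ =
        let i , i≡ = at {n} (<-trans (n<1+n x) (subst (_< n) A≡ (toℕ<n A)))
            A≡1+i  = trans A≡ (cong suc (sym i≡))
            a≤i    = s≤s⁻¹ (subst (toℕ a <_) A≡1+i a<ω⁻¹a)
            ωA≡a   = inverseʳ ω {a}
            ωA<ωi  = subst (Fin._< ω ⟨$⟩ʳ i) (sym ωA≡a) (Fin-≤∧≢⇒< (fixesBelow-≤ ω fix a≤i)
                       λ a≡ωi → 1+n≢n (trans (sym A≡1+i) (cong toℕ (⟨$⟩ʳ-injective ω (trans ωA≡a a≡ωi)))))
        in cong suc (trans (sym i≡) (cong toℕ (sym (proj₂ (proj₂ one) (A , A≡1+i , ωA<ωi)))))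

    increasing-from : ∀ {i j} → A Fin.≤ i → i Fin.< j → ω ⟨$⟩ʳ i Fin.< ω ⟨$⟩ʳ j
    increasing-from A≤i = increasing (≤-trans (≤-reflexive (sym descent-before-ω⁻¹a)) A≤i)

    -- Induction from the right end: the last entry is at most the last position, and the entries
    -- increase from `A` on.
    ω≤ : ∀ k → A Fin.≤ k → ω ⟨$⟩ʳ k Fin.≤ k
    ω≤ k A≤k = go (n ∸ suc (toℕ k)) k A≤k (m+[n∸m]≡n (toℕ<n k))
      where
      go : ∀ m k → A Fin.≤ k → suc (toℕ k) + m ≡ n → ω ⟨$⟩ʳ k Fin.≤ k
      go zero k A≤k eq = s≤s⁻¹ (≤-trans (toℕ<n _) (≤-reflexive (trans (sym eq) (+-identityʳ _))))
      go (suc m) k A≤k eq =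
        let k′ , k′≡ = at {n} (≤-trans (s≤s (m≤m+n (suc (toℕ k)) m)) (≤-reflexive (trans (cong suc (sym (+-suc (toℕ k) m))) eq)))
            k<k′ = ≤-reflexive (sym k′≡)
        in s≤s⁻¹ (≤-trans (increasing-from A≤k k<k′) (≤-trans
             (go m k′ (≤-trans A≤k (<⇒≤ k<k′)) 
               (trans (cong (λ x → suc x + m) k′≡) (trans (cong suc (sym (+-suc (toℕ k) m))) eq)))
             (≤-reflexive k′≡)))

module _ (ω : Permutation′ n) (big : Bigrassmannian ω) {a : Fin n}
         (fix : FixesBelow ω a) (moves : ω ⟨$⟩ʳ a ≢ a) where

  private
    A B : Fin n
    A = ω ⟨$⟩ˡ a
    B = ω ⟨$⟩ʳ a

  -- If y were not directly to the right of y − 1, then the entry that is there would lie strictly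
  -- between y − 1 and y.
  consecutive-positions : ∀ m y → toℕ y ≡ toℕ a + m → y Fin.< B → toℕ (ω ⟨$⟩ˡ y) ≡ toℕ A + m
  consecutive-positions zero y y≡ y<B =
    trans (cong (λ x → toℕ (ω ⟨$⟩ˡ x)) (toℕ-injective (trans y≡ (+-identityʳ _)))) (sym (+-identityʳ _))
  consecutive-positions (suc m) y y≡ y<B
    with (z , z≡) ← at {n} {toℕ a + m} (<-trans (≤-reflexive (trans (sym (+-suc (toℕ a) m)) (sym y≡))) (toℕ<n y)) =
    ≤-antisym (≮⇒≥ gap) (≤-trans (≤-reflexive (trans (+-suc (toℕ A) m) (cong suc (sym ω⁻¹z)))) ω⁻¹z<ω⁻¹y)
    where
    y≡1+z : toℕ y ≡ suc (toℕ z)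
    y≡1+z = trans y≡ (trans (+-suc (toℕ a) m) (cong suc (sym z≡)))
    z<y : z Fin.< y
    z<y = ≤-reflexive (sym y≡1+z)
    ω⁻¹z : toℕ (ω ⟨$⟩ˡ z) ≡ toℕ A + m
    ω⁻¹z = consecutive-positions m z z≡ (<-trans z<y y<B)
    -- The descent of the inverse comes just before `B`, while `y`, the successor of `z`, is below
    -- `B`.
    z≢q : z ≢ proj₁ (proj₂ big)
    z≢q refl = <⇒≱ y<B (≤-reflexive (trans
      (descent-before-ω⁻¹a (flip ω) (proj₂ big) (flip-fixesBelow ω fix) (flip-moves ω moves)) (sym y≡1+z)))
    ω⁻¹z<ω⁻¹y : ω ⟨$⟩ˡ z Fin.< ω ⟨$⟩ˡ y
    ω⁻¹z<ω⁻¹y = ascent (flip ω) (proj₂ big) y≡1+z z≢q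
    gap : ¬ toℕ A + suc m < toℕ (ω ⟨$⟩ˡ y)
    gap lt with (x , x≡) ← at {n} (<-trans lt (toℕ<n (ω ⟨$⟩ˡ y))) = <⇒≱ z<ωx (s≤s⁻¹ (≤-trans ωx<y (≤-reflexive y≡1+z)))
      where
      incr : ∀ {i j} → A Fin.≤ i → i Fin.< j → ω ⟨$⟩ʳ i Fin.< ω ⟨$⟩ʳ j
      incr = increasing-from ω (proj₁ big) fix moves
      x≡1+ : toℕ x ≡ suc (toℕ (ω ⟨$⟩ˡ z))
      x≡1+ = trans x≡ (trans (+-suc (toℕ A) m) (cong suc (sym ω⁻¹z)))
      ωx<y : ω ⟨$⟩ʳ x Fin.< y
      ωx<y = subst (ω ⟨$⟩ʳ x Fin.<_) (inverseʳ ω)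
        (incr (≤-trans (m≤m+n (toℕ A) (suc m)) (≤-reflexive (sym x≡))) (subst (_< toℕ (ω ⟨$⟩ˡ y)) (sym x≡) lt))
      z<ωx : z Fin.< ω ⟨$⟩ʳ x
      z<ωx = subst (Fin._< ω ⟨$⟩ʳ x) (inverseʳ ω)
        (incr (≤-trans (m≤m+n (toℕ A) m) (≤-reflexive (sym ω⁻¹z))) (≤-reflexive (sym x≡1+)))

module _ (ω : Permutation′ n) (big : Bigrassmannian ω) {a : Fin n}
         (fix : FixesBelow ω a) (moves : ω ⟨$⟩ʳ a ≢ a) where

  private
    A B : Fin n
    A = ω ⟨$⟩ˡ a
    B = ω ⟨$⟩ʳ a

  -- `B` and `A` are `a + U` and `a + V`. Consecutive positions for the inverse give the raised
  -- block, those for `ω` the lowered one; bounds in both directions fix the rest.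
  bigrassmannian-shape-from : ∃₂ λ o i → Shape ω o i
  bigrassmannian-shape-from = (toℕ a , n ∸ c) , (u , v) , shape (m+[n∸m]≡n c≤n) pieces
    where
    u v c : ℕ
    u = toℕ B ∸ suc (toℕ a)
    v = toℕ A ∸ suc (toℕ a)
    c = toℕ a + suc v + suc u
    fix′ : FixesBelow (flip ω) a
    fix′ = flip-fixesBelow ω fix
    A≡ : toℕ a + suc v ≡ toℕ A
    A≡ = trans (+-suc (toℕ a) v) (m+[n∸m]≡n (a<ω⁻¹a ω (proj₁ big) fix moves))
    B≡ : toℕ a + suc u ≡ toℕ B
    B≡ = trans (+-suc (toℕ a) u) (m+[n∸m]≡n (a<ω⁻¹a (flip ω) (proj₂ big) fix′ (flip-moves ω moves)))
    c≡ : toℕ B + suc v ≡ c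
    c≡ = trans (cong (_+ suc v) (sym B≡)) (xy∙z≈xz∙y (toℕ a) (suc u) (suc v))
    values : ∀ k → toℕ a ≤ toℕ k → k Fin.< A → toℕ (ω ⟨$⟩ʳ k) ≡ toℕ B + (toℕ k ∸ toℕ a)
    values k a≤k = consecutive-positions (flip ω) (proj₂ big , proj₁ big) fix′ (flip-moves ω moves)
      (toℕ k ∸ toℕ a) k (sym (m+[n∸m]≡n a≤k))
    -- The value just below `c` is attained at `a + v`, the last raised position.
    c≤n : c ≤ n
    c≤n =
      let a+v<A = subst (toℕ a + v <_) A≡ (+-monoʳ-< (toℕ a) (n<1+n v))
          i , i≡ = at (<-trans a+v<A (toℕ<n A))
          ωi = values i (subst (toℕ a ≤_) (sym i≡) (m≤m+n (toℕ a) v)) (subst (_< toℕ A) (sym i≡) a+v<A)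
      in ≤-trans (≤-reflexive (trans (sym c≡) (trans (+-suc (toℕ B) v)
           (cong suc (sym (trans ωi (cong (toℕ B +_) (trans (cong (_∸ toℕ a) i≡) (m+n∸m≡n (toℕ a) v)))))))))
           (toℕ<n (ω ⟨$⟩ʳ i))
    pieces : ∀ k → Piece (toℕ a) (suc u) (suc v) (toℕ k) (toℕ (ω ⟨$⟩ʳ k))
    pieces k with piece-total {toℕ a} {suc u} {suc v} (toℕ k)
    ... | _ , fixedˡ k<a _ = fixedˡ k<a (cong toℕ (fix k k<a))
    ... | _ , raised a≤k k<b _ = raised a≤k k<b (trans (values k a≤k (subst (toℕ k <_) A≡ k<b))
          (trans (cong (_+ (toℕ k ∸ toℕ a)) (sym B≡)) (trans (xy∙z≈xz∙y (toℕ a) (suc u) _)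
          (cong (_+ suc u) (m+[n∸m]≡n a≤k)))))
    ... | l , lowered b≤k k<c l+V≡k =
      lowered b≤k k<c (trans (cong (λ x → toℕ x + suc v) ωk≡y) (trans (cong (_+ suc v) y≡) l+V≡k))
      where
      a≤l : toℕ a ≤ l
      a≤l = +-cancelʳ-≤ (suc v) (toℕ a) l (≤-trans b≤k (≤-reflexive (sym l+V≡k)))
      l<B : l < toℕ B
      l<B = +-cancelʳ-< (suc v) l (toℕ B) (subst₂ _<_ (sym l+V≡k) (sym c≡) k<c)
      y : Fin n
      y = proj₁ (at (<-trans l<B (toℕ<n B)))
      y≡ : toℕ y ≡ l
      y≡ = proj₂ (at (<-trans l<B (toℕ<n B)))
      ω⁻¹y≡k : toℕ (ω ⟨$⟩ˡ y) ≡ toℕ k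
      ω⁻¹y≡k = trans
        (consecutive-positions ω big fix moves (l ∸ toℕ a) y (trans y≡ (sym (m+[n∸m]≡n a≤l)))
          (subst (_< toℕ B) (sym y≡) l<B))
        (trans (cong (_+ (l ∸ toℕ a)) (sym A≡)) (trans (xy∙z≈xz∙y (toℕ a) (suc v) _)
        (trans (cong (_+ suc v) (m+[n∸m]≡n a≤l)) l+V≡k)))
      ωk≡y : ω ⟨$⟩ʳ k ≡ y
      ωk≡y = trans (cong (ω ⟨$⟩ʳ_) (sym (toℕ-injective ω⁻¹y≡k))) (inverseʳ ω)
    ... | _ , fixedʳ c≤k _ = fixedʳ c≤k (≤-antisym
            (ω≤ ω (proj₁ big) fix moves k (≤-trans (≤-reflexive (sym A≡)) (≤-trans (m≤m+n _ (suc u)) c≤k)))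
            (≮⇒≥ not-below))
      where
      -- Values below `a` are fixed, values from `a` to below `B` stand at positions before `c`, and
      -- from `B` on the inverse obeys `ω≤`.
      not-below : ¬ ω ⟨$⟩ʳ k Fin.< k
      not-below ωk<k with toℕ (ω ⟨$⟩ʳ k) <? toℕ a | toℕ (ω ⟨$⟩ʳ k) <? toℕ B
      ... | yes ωk<a | _ = <-irrefl (cong toℕ (⟨$⟩ʳ-injective ω (fix _ ωk<a))) ωk<k
      ... | no ωk≮a | yes ωk<B = <⇒≱
            (+-cancelˡ-< (toℕ a) _ _ (subst₂ _<_ (sym (m+[n∸m]≡n (≮⇒≥ ωk≮a))) (sym B≡) ωk<B))
            (+-cancelˡ-≤ (toℕ A) (suc u) _ (≤-trans (≤-reflexive (cong (_+ suc u) (sym A≡)))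
              (≤-trans c≤k (≤-reflexive (trans (cong toℕ (sym (inverseˡ ω)))
                (consecutive-positions ω big fix moves _ (ω ⟨$⟩ʳ k) (sym (m+[n∸m]≡n (≮⇒≥ ωk≮a))) ωk<B))))))
      ... | no _ | no ωk≮B = <⇒≱ ωk<k (subst (Fin._≤ ω ⟨$⟩ʳ k) (inverseˡ ω)
            (ω≤ (flip ω) (proj₂ big) fix′ (flip-moves ω moves) (ω ⟨$⟩ʳ k) (≮⇒≥ ωk≮B)))

-- The least moved point serves as `a`; it exists because a descent excludes the identity.
bigrassmannian-shape : ∀ (ω : Permutation′ n) → Bigrassmannian ω → ∃₂ λ o i → Shape ω o i
bigrassmannian-shape {n} ω big@((p , (j , j≡ , d) , _) , _) =
  let a , moves , fix = ¬∀⟶∃¬-smallest n (λ k → ω ⟨$⟩ʳ k ≡ k) (λ k → ω ⟨$⟩ʳ k ≟ k) not-identity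
  in bigrassmannian-shape-from ω big {a}
       -- The search returns points below `a` as elements of `Fin (toℕ a)`, to be identified with
       -- elements of `Fin n`.
       (λ k k<a → let x≡k = toℕ-injective (trans (toℕ-inject (fromℕ< k<a)) (toℕ-fromℕ< k<a))
                  in subst (λ x → ω ⟨$⟩ʳ x ≡ x) x≡k (fix (fromℕ< k<a)))
       moves
  where
  not-identity : ¬ (∀ k → ω ⟨$⟩ʳ k ≡ k)
  not-identity fixed = <⇒≱ (subst₂ Fin._<_ (fixed j) (fixed p) d) (≤-trans (n≤1+n _) (≤-reflexive (sym j≡)))

-- One-line notation and length vectors

-- Indexing is a relation, so positions in concatenated lists need no casts between `Fin` types.
data At {X : Set} : List X → ℕ → X → Set where
  here  : ∀ {x xs} → At (x ∷ xs) zero x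
  there : ∀ {x y xs i} → At xs i x → At (y ∷ xs) (suc i) x

at-unique : ∀ {xs : List X} {i x y} → At xs i x → At xs i y → x ≡ y
at-unique here      here      = refl
at-unique (there p) (there q) = at-unique p q

at-map : ∀ (f : X → Y) {xs i x} → At xs i x → At (map f xs) i (f x)
at-map f here      = here
at-map f (there p) = there (at-map f p)

at-tabulate : ∀ (f : Fin n → X) i → At (tabulate f) (toℕ i) (f i)
at-tabulate f Fin.zero    = here
at-tabulate f (Fin.suc i) = there (at-tabulate (λ i → f (Fin.suc i)) i)

at-applyUpTo : ∀ (f : ℕ → X) {m i} → i < m → At (applyUpTo f m) i (f i)
at-applyUpTo f {suc m} {zero}  _         = here
at-applyUpTo f {suc m} {suc i} (s≤s i<m) = there (at-applyUpTo (λ i → f (suc i)) i<m)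

at-++ˡ : ∀ {xs ys : List X} {i x} → At xs i x → At (xs ++ ys) i x
at-++ˡ here      = here
at-++ˡ (there p) = there (at-++ˡ p)

at-++ʳ : ∀ (xs : List X) {ys i x} → At ys i x → At (xs ++ ys) (length xs + i) x
at-++ʳ []       p = p
at-++ʳ (_ ∷ xs) p = there (at-++ʳ xs p)

at-≡ : ∀ {xs : List X} {i j x y} → i ≡ j → x ≡ y → At xs i x → At xs j y
at-≡ refl refl p = p

length-block : ∀ a m → length (block a (a + m)) ≡ m
length-block a m = trans (length-applyUpTo _ _) (m+n∸m≡n a m)

at-block : ∀ a {m i} → i < m → At (block a (a + m)) i (suc (a + i))
at-block a {m} i<m = at-applyUpTo _ (subst (_ <_) (sym (m+n∸m≡n a m)) i<m)

at-after-block : ∀ a m {ys i k x} → m + i ≡ k → At ys i x → At (block a (a + m) ++ ys) k x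
at-after-block a m refl p = at-≡ (cong (_+ _) (length-block a m)) refl (at-++ʳ (block a (a + m)) p)

-- The position is counted from the start of its block; `suc l` appears because one-line notation
-- starts at 1.
at-piece : ∀ a U V y {k l} → k < a + U + V + y → Piece a U V k l →
  At (block 0 a ++ block (a + U) (a + U + V) ++ block a (a + U) ++ block (a + U + V) (a + U + V + y))
     k (suc l)
at-piece a U V y k<n (fixedˡ k<a refl) = at-++ˡ (at-block 0 k<a)
at-piece a U V y {k} k<n (raised a≤k k<b refl) =
  at-after-block 0 a (m+[n∸m]≡n a≤k) (at-++ˡ (at-≡ refl (cong suc
    (trans (xy∙z≈xz∙y a U (k ∸ a)) (cong (_+ U) (m+[n∸m]≡n a≤k))))
    (at-block (a + U) (+-cancelˡ-< a (k ∸ a) V (subst (_< a + V) (sym (m+[n∸m]≡n a≤k)) k<b)))))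
at-piece a U V y {k} {l} k<n (lowered b≤k k<c refl) =
  at-after-block 0 a (trans (cong (a +_) (+-comm V (l ∸ a))) (trans (sym (+-assoc a (l ∸ a) V)) (cong (_+ V) a+[l∸a])))
    (at-after-block (a + U) V refl (at-++ˡ (at-≡ refl (cong suc a+[l∸a])
      (at-block a (+-cancelˡ-< a (l ∸ a) U (subst (_< a + U) (sym a+[l∸a])
        (+-cancelʳ-< V l (a + U) (<-≤-trans k<c (≤-reflexive (xy∙z≈xz∙y a V U))))))))))
  where
  a+[l∸a] : a + (l ∸ a) ≡ l
  a+[l∸a] = m+[n∸m]≡n (+-cancelʳ-≤ V a l b≤k)
at-piece a U V y {k} k<n (fixedʳ c≤k refl) =
  at-after-block 0 a (trans (sym (+-assoc a V (U + i))) (trans (sym (+-assoc (a + V) U i)) a+V+U+i))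
    (at-after-block (a + U) V refl (at-after-block a U refl (at-≡ refl (cong suc
      (trans (cong (_+ i) (xy∙z≈xz∙y a U V)) a+V+U+i))
      (at-block (a + U + V) (+-cancelˡ-< (a + U + V) i y
        (subst (_< a + U + V + y) (sym (trans (cong (_+ i) (xy∙z≈xz∙y a U V)) a+V+U+i)) k<n))))))
  where
  i : ℕ
  i = k ∸ (a + V + U)
  a+V+U+i : a + V + U + i ≡ k
  a+V+U+i = m+[n∸m]≡n c≤k

-- A list holds a single entry at each position, so the given one-line notation determines all
-- values.
lengthVector-shape : ∀ (ω : 𝔅 n) {ℓ₁ ℓ₂ ℓ₃ ℓ₄} → HasLengthVector ω ℓ₁ ℓ₂ ℓ₃ ℓ₄ →
  ∃₂ λ a y → ∃₂ λ u v → Shape (proj₁ ω) (a , y) (u , v) × ℓ₁ ≡ suc a × ℓ₂ ≡ suc u × ℓ₃ ≡ suc v × ℓ₄ ≡ suc y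
lengthVector-shape {n} (ω , _) (a , b , c , (a<b , b<c , c≤n) , line , refl , refl , refl , refl) =
  a , n ∸ c , b ∸ suc a , c ∸ suc b
  , shape (trans (cong (_+ (n ∸ c)) (xy∙z≈xz∙y a V U)) n≡) pieces
  , refl , +-∸-assoc 1 a<b , +-∸-assoc 1 b<c , +-∸-assoc 1 c≤n
  where
  U V : ℕ
  U = suc (b ∸ suc a)
  V = suc (c ∸ suc b)
  b≡ : a + U ≡ b
  b≡ = trans (+-suc a _) (m+[n∸m]≡n a<b)
  c≡ : a + U + V ≡ c
  c≡ = trans (cong (_+ V) b≡) (trans (+-suc b _) (m+[n∸m]≡n b<c))
  n≡ : a + U + V + (n ∸ c) ≡ n
  n≡ = trans (cong (_+ (n ∸ c)) c≡) (m+[n∸m]≡n c≤n)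
  line′ : oneLine ω ≡ block 0 a ++ block (a + U) (a + U + V) ++ block a (a + U)
                        ++ block (a + U + V) (a + U + V + (n ∸ c))
  line′ rewrite n≡ | c≡ | b≡ = line
  pieces : ∀ k → Piece a U V (toℕ k) (toℕ (ω ⟨$⟩ʳ k))
  pieces k =
    let l , p = piece-total (toℕ k)
        at-l = at-piece a U V (n ∸ c) (subst (toℕ k <_) (sym n≡) (toℕ<n k)) p
    in subst (Piece a U V (toℕ k))
         (suc-injective (at-unique (subst (λ xs → At xs (toℕ k) (suc l)) (sym line′) at-l) (at-map _ (at-tabulate _ k)))) p

-- Saturated chains

-- Opaque, as unfolding the search for the first moved point makes conversion checking intractable.
opaque
  coordinates : ∀ (ω : 𝔅 n) → ∃₂ λ o i → Shape (proj₁ ω) o i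
  coordinates (ω , big) = bigrassmannian-shape ω big

outer inner : 𝔅 n → ℕ × ℕ
outer ω = proj₁ (coordinates ω)
inner ω = proj₁ (proj₂ (coordinates ω))

hasShape : ∀ (ω : 𝔅 n) → Shape (proj₁ ω) (outer ω) (inner ω)
hasShape ω = proj₂ (proj₂ (coordinates ω))

opaque

  ≤𝔅⇒≤² : ∀ (π σ : 𝔅 n) → π ≤𝔅 σ → outer σ ≤² outer π × inner π ≤² inner σ
  ≤𝔅⇒≤² π σ = ≤ᴮ⇒≤² (hasShape π) (hasShape σ)

  ≤²⇒≤𝔅 : ∀ (π σ : 𝔅 n) → outer σ ≤² outer π → inner π ≤² inner σ → π ≤𝔅 σ
  ≤²⇒≤𝔅 π σ = ≤²⇒≤ᴮ (hasShape π) (hasShape σ)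

  -- Reflexivity of the Bruhat order, read through `≤ᴮ⇒≤²` in both directions, bounds the pairs from
  -- both sides. The search behind `coordinates` is never inspected.
  shape-coordinates : ∀ (π : 𝔅 n) {σ o i} → proj₁ π ≈ σ → Shape σ o i → outer π ≡ o × inner π ≡ i
  shape-coordinates π {σ} π≈σ s =
    let o≤ , i≤ = ≤ᴮ⇒≤² (hasShape π) s (≤ᴮ-reflexive {π = proj₁ π} {σ} (λ k → sym (π≈σ k)))
        ≤o , ≤i = ≤ᴮ⇒≤² s (hasShape π) (≤ᴮ-reflexive {π = σ} {proj₁ π} π≈σ)
    in ≤²-antisym ≤o o≤ , ≤²-antisym i≤ ≤i

  ≈𝔅⇒≡ : ∀ (π σ : 𝔅 n) → π ≈𝔅 σ → outer π ≡ outer σ × inner π ≡ inner σ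
  ≈𝔅⇒≡ π σ eq = shape-coordinates π eq (hasShape σ)

  ≡⇒≈𝔅 : ∀ (π σ : 𝔅 n) → outer π ≡ outer σ → inner π ≡ inner σ → π ≈𝔅 σ
  ≡⇒≈𝔅 π σ o≡ i≡ = shape-≈ (hasShape π) (subst₂ (Shape (proj₁ σ)) (sym o≡) (sym i≡) (hasShape σ))

  size-coordinates : ∀ (π : 𝔅 n) → size (outer π) + size (inner π) + 2 ≡ n
  size-coordinates π = shape-size (hasShape π)

  sizes-≡ : ∀ (π σ : 𝔅 n) → size (outer π) + size (inner π) ≡ size (outer σ) + size (inner σ)
  sizes-≡ π σ = shape-sizes (hasShape π) (hasShape σ)

  element : ∀ o i → size o + size i + 2 ≡ n → ∃[ ω ] outer {n} ω ≡ o × inner ω ≡ i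
  element o i eq =
    let ω , s = shape-exists o i eq
        ω𝔅    = ω , shape-bigrassmannian s
    in ω𝔅 , shape-coordinates ω𝔅 (λ _ → refl) s

record Step (π σ : 𝔅 n) : Set where
  constructor step
  field
    outerLetter innerLetter : Bool
    outer-step : outer π ≡ bump outerLetter (outer σ)
    inner-step : inner σ ≡ bump innerLetter (inner π)

open Step

-- The size of the inner pair serves as a rank: at equal sizes the inner pairs agree, and then the
-- outer ones by the common total.
<𝔅⇒size< : ∀ (π σ : 𝔅 n) → π <𝔅 σ → size (inner π) < size (inner σ)
<𝔅⇒size< π σ (π≤σ , π≉σ) with o≤ , i≤ ← ≤𝔅⇒≤² π σ π≤σ with m≤n⇒m<n∨m≡n (size-mono i≤)
... | inj₁ lt = lt
... | inj₂ eq = contradiction (≡⇒≈𝔅 π σ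
      (sym (≤²-size-≡ o≤ (+-cancelʳ-≡ (size (inner π)) _ _
        (trans (cong (size (outer σ) +_) eq) (sizes-≡ σ π)))))
      (≤²-size-≡ i≤ eq)) π≉σ

-- The rank rises by only one, which leaves no room for two strict increases.
step⇒◁ : ∀ {π σ : 𝔅 n} → Step π σ → π ◁ σ
step⇒◁ {π = π} {σ} (step β γ o≡ i≡) = (π≤σ , π≉σ) , nothing-between
  where
  π≤σ : π ≤𝔅 σ
  π≤σ = ≤²⇒≤𝔅 π σ (subst (outer σ ≤²_) (sym o≡) (≤²-bump β (outer σ)))
                   (subst (inner π ≤²_) (sym i≡) (≤²-bump γ (inner π)))
  π≉σ : ¬ π ≈𝔅 σ
  π≉σ eq = ≢-bump γ (inner π) (trans (proj₂ (≈𝔅⇒≡ π σ eq)) i≡)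
  nothing-between : ¬ (∃[ ρ ] π <𝔅 ρ × ρ <𝔅 σ)
  nothing-between (ρ , π<ρ , ρ<σ) = <⇒≱ (<𝔅⇒size< ρ σ ρ<σ)
    (≤-trans (≤-reflexive (trans (cong size i≡) (size-bump γ (inner π)))) (<𝔅⇒size< π ρ π<ρ))

opaque

  -- One unit above `π` there is an element `ρ` below `σ`. With a smaller rank than `σ` it would lie
  -- strictly between; hence it has the coordinates of `σ`.
  ◁⇒step : ∀ (π σ : 𝔅 n) → π ◁ σ → Step π σ
  ◁⇒step {n} π σ (π<σ@(π≤σ , π≉σ) , nothing-between) =
    let γ , γ≤      = ≤²-bump⁺ i≤ i<
        β , o , o≡ , ≤o = ≤²-bump⁻ o≤ o<
        ρ , ρo , ρi = element {n} o (bump γ (inner π)) (trans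
          (cong (_+ 2) (trans (size-exchange β o γ (inner π)) (cong (λ p → size p + size (inner π)) (sym o≡))))
          (size-coordinates π))
    in finish β γ o≡ ρ ρo ρi ≤o γ≤
    where
    o≤ : outer σ ≤² outer π
    o≤ = proj₁ (≤𝔅⇒≤² π σ π≤σ)
    i≤ : inner π ≤² inner σ
    i≤ = proj₂ (≤𝔅⇒≤² π σ π≤σ)
    i< : size (inner π) < size (inner σ)
    i< = <𝔅⇒size< π σ π<σ
    o< : size (outer σ) < size (outer π)
    o< = +-cancelʳ-< (size (inner π)) _ _
      (<-≤-trans (+-monoʳ-< (size (outer σ)) i<) (≤-reflexive (sizes-≡ σ π)))
    -- The pair `o` is a variable here, so that `outer ρ ≡ o` can be matched with `refl`.
    finish : ∀ β γ {o} → outer π ≡ bump β o → ∀ (ρ : 𝔅 n) → outer ρ ≡ o → inner ρ ≡ bump γ (inner π) →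
      outer σ ≤² o → bump γ (inner π) ≤² inner σ → Step π σ
    finish β γ o≡ ρ refl ρi ≤o γ≤ with m≤n⇒m<n∨m≡n (size-mono γ≤)
    ... | inj₁ lt = contradiction (ρ , (π≤ρ , π≉ρ) , (ρ≤σ , ρ≉σ)) nothing-between
      where
      π≤ρ : π ≤𝔅 ρ
      π≤ρ = ≤²⇒≤𝔅 π ρ (subst (outer ρ ≤²_) (sym o≡) (≤²-bump β (outer ρ)))
                       (subst (inner π ≤²_) (sym ρi) (≤²-bump γ (inner π)))
      π≉ρ : ¬ π ≈𝔅 ρ
      π≉ρ eq = ≢-bump γ (inner π) (trans (proj₂ (≈𝔅⇒≡ π ρ eq)) ρi)
      ρ≤σ : ρ ≤𝔅 σ
      ρ≤σ = ≤²⇒≤𝔅 ρ σ ≤o (subst (_≤² inner σ) (sym ρi) γ≤)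
      ρ≉σ : ¬ ρ ≈𝔅 σ
      ρ≉σ eq = <⇒≢ lt (cong size (trans (sym ρi) (proj₂ (≈𝔅⇒≡ ρ σ eq))))
    ... | inj₂ eq = step β γ (trans o≡ (cong (bump β) (sym σo≡ρo))) (sym γ≡)
      where
      γ≡ : bump γ (inner π) ≡ inner σ
      γ≡ = ≤²-size-≡ γ≤ eq
      σo≡ρo : outer σ ≡ outer ρ
      σo≡ρo = ≤²-size-≡ ≤o (+-cancelʳ-≡ (size (inner σ)) _ _ (trans (sizes-≡ σ ρ)
        (cong (λ p → size (outer ρ) + size p) (trans ρi γ≡))))

module _ {π σ π′ σ′ : 𝔅 n} (s : Step π σ) (s′ : Step π′ σ′) (π≈ : π ≈𝔅 π′) where

  step-cong : σ ≈𝔅 σ′ → outerLetter s ≡ outerLetter s′ × innerLetter s ≡ innerLetter s′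
  step-cong σ≈ with πo , πi ← ≈𝔅⇒≡ π π′ π≈ with σo , σi ← ≈𝔅⇒≡ σ σ′ σ≈ =
    bump-injectiveˡ (outer σ) (trans (sym (outer-step s)) (trans πo (trans (outer-step s′) (cong (bump _) (sym σo)))))
    , bump-injectiveˡ (inner π) (trans (sym (inner-step s)) (trans σi (trans (inner-step s′) (cong (bump _) (sym πi)))))

  step-injective : outerLetter s ≡ outerLetter s′ → innerLetter s ≡ innerLetter s′ → σ ≈𝔅 σ′
  step-injective o≡ i≡ with πo , πi ← ≈𝔅⇒≡ π π′ π≈ = ≡⇒≈𝔅 σ σ′
    (bump-injectiveʳ (outerLetter s) (trans (sym (outer-step s)) (trans πo (trans (outer-step s′)
      (cong (λ β → bump β (outer σ′)) (sym o≡))))))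
    (trans (inner-step s) (trans (cong₂ bump i≡ πi) (sym (inner-step s′))))

-- Words of a saturated chain

outerWord innerWord : ∀ {k} {xs : Vec (𝔅 n) (suc k)} → Linked _◁_ xs → List Bool
outerWord [-]      = []
outerWord {xs = x ∷ xs} (c ∷ cs) = outerLetter (◁⇒step x (head xs) c) ∷ outerWord cs
innerWord [-]      = []
innerWord {xs = x ∷ xs} (c ∷ cs) = innerLetter (◁⇒step x (head xs) c) ∷ innerWord cs

length-outerWord : ∀ {k} {xs : Vec (𝔅 n) (suc k)} (cs : Linked _◁_ xs) → length (outerWord cs) ≡ k
length-outerWord [-]      = refl
length-outerWord {xs = x ∷ xs} (c ∷ cs) = cong suc (length-outerWord cs)

length-innerWord : ∀ {k} {xs : Vec (𝔅 n) (suc k)} (cs : Linked _◁_ xs) → length (innerWord cs) ≡ k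
length-innerWord [-]      = refl
length-innerWord {xs = x ∷ xs} (c ∷ cs) = cong suc (length-innerWord cs)

outer-start : ∀ {k} {xs : Vec (𝔅 n) (suc k)} (cs : Linked _◁_ xs) →
  outer (head xs) ≡ bumps (outerWord cs) (outer (last xs))
outer-start [-]      = refl
outer-start {xs = x ∷ xs} (c ∷ cs) = trans (outer-step (◁⇒step x (head xs) c)) (cong (bump _) (outer-start cs))

inner-end : ∀ {k} {xs : Vec (𝔅 n) (suc k)} (cs : Linked _◁_ xs) →
  inner (last xs) ≡ bumps (innerWord cs) (inner (head xs))
inner-end [-]      = refl
inner-end {xs = x ∷ xs} (c ∷ cs) = trans (inner-end cs)
  (trans (cong (bumps (innerWord cs)) (inner-step (◁⇒step x (head xs) c))) (bumps-bump (innerWord cs) _ _))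

-- Letters are extracted from covering proofs, but the coordinates of the two permutations already
-- determine them.
words-cong : ∀ {k k′} {xs : Vec (𝔅 n) (suc k)} {ys : Vec (𝔅 n) (suc k′)}
  (cs : Linked _◁_ xs) (ds : Linked _◁_ ys) →
  Pointwise _≈𝔅_ xs ys → outerWord cs ≡ outerWord ds × innerWord cs ≡ innerWord ds
words-cong [-] [-] _ = refl , refl
words-cong {ys = _ ∷ _ ∷ _} [-] (_ ∷ _) (_ ∷ ())
words-cong {xs = _ ∷ _ ∷ _} (_ ∷ _) [-] (_ ∷ ())
words-cong {xs = x ∷ xs} {y ∷ ys} (c ∷ cs) (d ∷ ds) (x≈y ∷ p@(x≈y′ ∷ _)) =
  let o≡ , i≡   = step-cong (◁⇒step x (head xs) c) (◁⇒step y (head ys) d) x≈y x≈y′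
      os≡ , is≡ = words-cong cs ds p
  in cong₂ _∷_ o≡ os≡ , cong₂ _∷_ i≡ is≡

-- Given its lower element, each step is fixed by its two letters.
words-injective : ∀ {k k′} {xs : Vec (𝔅 n) (suc k)} {ys : Vec (𝔅 n) (suc k′)}
  (cs : Linked _◁_ xs) (ds : Linked _◁_ ys) →
  head xs ≈𝔅 head ys → outerWord cs ≡ outerWord ds → innerWord cs ≡ innerWord ds → Pointwise _≈𝔅_ xs ys
words-injective [-]      [-]      x≈y _ _ = x≈y ∷ []
words-injective {xs = x ∷ xs} {y ∷ ys} (c ∷ cs) (d ∷ ds) x≈y os≡ is≡ =
  let o≡ , os≡′ = ∷-injective os≡
      i≡ , is≡′ = ∷-injective is≡
  in x≈y ∷ words-injective cs ds (step-injective (◁⇒step x (head xs) c) (◁⇒step y (head ys) d) x≈y o≡ i≡) os≡′ is≡′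

-- `o` belongs to the top and `i` to the bottom of the chain; the words supply the other pair at
-- either end.
record Realisation (n : ℕ) (o i : ℕ × ℕ) (v w : List Bool) : Set where
  field
    chain      : SaturatedChain n
    start-outer : outer (start chain) ≡ bumps v o
    start-inner : inner (start chain) ≡ i
    outerWord-≡ : outerWord (covers chain) ≡ v
    innerWord-≡ : innerWord (covers chain) ≡ w

  end-outer : outer (end chain) ≡ o
  end-outer = bumps-injectiveʳ v (trans (cong (λ u → bumps u (outer (end chain))) (sym outerWord-≡))
    (trans (sym (outer-start (covers chain))) start-outer))

  end-inner : inner (end chain) ≡ bumps w i
  end-inner = trans (inner-end (covers chain)) (cong₂ bumps innerWord-≡ start-inner)

-- The chain grows downwards: a new bottom element with one more outer unit is put before a chain
-- starting at inner pair `bump γ i`. The size condition makes the bottom element exist.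
realise : ∀ o i v w → length v ≡ length w → size (bumps v o) + size i + 2 ≡ n → Realisation n o i v w
realise o i [] [] _ eq =
  let ω , o≡ , i≡ = element o i eq in record
  { chain       = record { steps = 0 ; elements = ω ∷ [] ; covers = [-] }
  ; start-outer = o≡
  ; start-inner = i≡
  ; outerWord-≡ = refl
  ; innerWord-≡ = refl
  }
realise {n} o i (β ∷ v) (γ ∷ w) len eq =
  let ω , o≡ , i≡ = element (bump β (bumps v o)) i eq
      s : Step ω (start chain)
      s = step β γ (trans o≡ (cong (bump β) (sym start-outer))) (trans start-inner (cong (bump γ) (sym i≡)))
      -- `◁⇒step` recomputes a step from the covering proof; its letters must be compared with those
      -- of `s`.
      o≡ᵂ , i≡ᵂ = step-cong (◁⇒step ω (start chain) (step⇒◁ s)) s (λ _ → refl) (λ _ → refl)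
  in record
  { chain       = record
    { steps    = suc (steps chain)
    ; elements = ω ∷ elements chain
    ; covers   = step⇒◁ s ∷ covers chain
    }
  ; start-outer = o≡
  ; start-inner = i≡
  ; outerWord-≡ = cong₂ _∷_ o≡ᵂ outerWord-≡
  ; innerWord-≡ = cong₂ _∷_ i≡ᵂ innerWord-≡
  }
  where open Realisation (realise {n} o (bump γ i) v w (suc-injective len)
               (trans (cong (_+ 2) (size-exchange β (bumps v o) γ i)) eq))

-- Chains between two elements

hasCardinality : ∀ {S : Setoid 0ℓ 0ℓ} {A : Set} {k} → A ↔ Fin k → (f : Setoid.Carrier S → A) →
  (∀ {x y} → Setoid._≈_ S x y → f x ≡ f y) → (∀ {x y} → f x ≡ f y → Setoid._≈_ S x y) →
  (∀ a → ∃[ x ] f x ≡ a) → HasCardinality S k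
hasCardinality {S} {A} A↔Fin f cong-f injective surjective = inverse (Bijection⇒Inverse bijection) A↔Fin
  where
  bijection : Bijection S (setoid A)
  bijection = record
    { to        = f
    ; cong      = cong-f
    ; bijective = injective , λ a → let x , fx≡a = surjective a in x , λ z≈x → trans (cong-f z≈x) fx≡a
    }

-- For outer pairs this is the `r` of the theorem, since the units added in `ℓ₁`, `m₁`, `ℓ₄`, `m₄`
-- cancel.
gap : ℕ × ℕ → ℕ × ℕ → ℕ
gap (x , y) (x′ , y′) = (x ∸ x′) + (y ∸ y′)

gap+size : ∀ {p q} → q ≤² p → gap p q + size q ≡ size p
gap+size {x , y} {x′ , y′} (x′≤x , y′≤y) = trans (interchange (x ∸ x′) (y ∸ y′) x′ y′)
  (cong₂ _+_ (m∸n+n≡m x′≤x) (m∸n+n≡m y′≤y))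

bumps-length : ∀ {p q} w → q ≤² p → p ≡ bumps w q → length w ≡ gap p q
bumps-length {p} {q} w q≤p eq = +-cancelʳ-≡ (size q) (length w) (gap p q)
  (trans (sym (size-bumps w q)) (trans (cong size (sym eq)) (sym (gap+size q≤p))))

bumps-trues : ∀ {p q} w → p ≡ bumps w q → trues w ≡ proj₁ p ∸ proj₁ q
bumps-trues {p} {q} w eq = sym (trans (cong (_∸ proj₁ q) (trans (cong proj₁ eq) (proj₁-bumps w q)))
  (m+n∸n≡m (trues w) (proj₁ q)))

-- The number of `true` fixes the first coordinate; the length fixes the sum and hence the second.
bumps-determined : ∀ {p q} w → q ≤² p → length w ≡ gap p q → trues w ≡ proj₁ p ∸ proj₁ q → bumps w q ≡ p
bumps-determined {p} {q} w q≤p len tr = cong₂ _,_ proj₁-≡ (+-cancelˡ-≡ (proj₁ p) _ _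
  (trans (cong (_+ proj₂ (bumps w q)) (sym proj₁-≡))
    (trans (size-bumps w q) (trans (cong (_+ size q) len) (gap+size q≤p)))))
  where
  proj₁-≡ : proj₁ (bumps w q) ≡ proj₁ p
  proj₁-≡ = trans (proj₁-bumps w q) (trans (cong (_+ proj₁ q) tr) (m∸n+n≡m (proj₁ q≤p)))

balance : ∀ g h b c → g + b + c ≡ b + (h + c) → g ≡ h
balance g h b c eq = +-cancelʳ-≡ (b + c) g h (trans (sym (+-assoc g b c)) (trans eq (x∙yz≈y∙xz b h c)))

-- What the outer pair loses the inner pair gains, so both words have the same length.
gap-≡ : ∀ (π σ : 𝔅 n) → outer σ ≤² outer π → inner π ≤² inner σ → gap (outer π) (outer σ) ≡ gap (inner σ) (inner π)
gap-≡ π σ o≤ i≤ = balance _ (gap (inner σ) (inner π)) (size (outer σ)) (size (inner π))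
  (trans (cong (_+ size (inner π)) (gap+size o≤))
  (trans (sizes-≡ π σ) (cong (size (outer σ) +_) (sym (gap+size i≤)))))

module _ (π σ : 𝔅 n) (π≤σ : π ≤𝔅 σ) where

  private
    o≤ : outer σ ≤² outer π
    o≤ = proj₁ (≤𝔅⇒≤² π σ π≤σ)
    i≤ : inner π ≤² inner σ
    i≤ = proj₂ (≤𝔅⇒≤² π σ π≤σ)
    r : ℕ
    r = gap (outer π) (outer σ)
    r≡ : r ≡ gap (inner σ) (inner π)
    r≡ = gap-≡ π σ o≤ i≤

  module _ (x : SaturatedChain n) (between : Between π σ x) where

    between-outer : outer π ≡ bumps (outerWord (covers x)) (outer σ)
    between-outer = trans (sym (proj₁ (≈𝔅⇒≡ (start x) π (proj₁ between))))
      (trans (outer-start (covers x)) (cong (bumps (outerWord (covers x))) (proj₁ (≈𝔅⇒≡ (end x) σ (proj₂ between)))))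

    between-inner : inner σ ≡ bumps (innerWord (covers x)) (inner π)
    between-inner = trans (sym (proj₂ (≈𝔅⇒≡ (end x) σ (proj₂ between))))
      (trans (inner-end (covers x)) (cong (bumps (innerWord (covers x))) (proj₂ (≈𝔅⇒≡ (start x) π (proj₁ between)))))

    between-steps : steps x ≡ r
    between-steps = trans (sym (length-outerWord (covers x))) (bumps-length (outerWord (covers x)) o≤ between-outer)

  -- The start is prescribed, so the words determine the chain; each word is constrained only by its
  -- length and its number of `true`.
  between-cardinality : HasCardinality (chainsSatisfying (Between π σ))
    ((r C (proj₁ (outer π) ∸ proj₁ (outer σ))) * (r C (proj₁ (inner σ) ∸ proj₁ (inner π))))
  between-cardinality = hasCardinality
    (↔-sym *↔× ↔-∘ (markedWords r _ ×-↔ markedWords r _))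
    (λ (x , b) →
      ( outerWord (covers x) , bumps-length (outerWord (covers x)) o≤ (between-outer x b)
      , bumps-trues (outerWord (covers x)) (between-outer x b)) ,
      ( innerWord (covers x) , trans (bumps-length (innerWord (covers x)) i≤ (between-inner x b)) (sym r≡)
      , bumps-trues (innerWord (covers x)) (between-inner x b)))
    (λ {(x , _)} {(y , _)} x≈y → let os , is = words-cong (covers x) (covers y) x≈y
      in cong₂ _,_ (MarkedWord-≡ os) (MarkedWord-≡ is))
    (λ {(x , x-start , _)} {(y , y-start , _)} eq → words-injective (covers x) (covers y)
      (λ k → trans (x-start k) (sym (y-start k))) (cong (λ ws → proj₁ (proj₁ ws)) eq) (cong (λ ws → proj₁ (proj₂ ws)) eq))
    (λ ((v , v-length , v-trues) , (w , w-length , w-trues)) →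
      let v-path = bumps-determined v o≤ v-length v-trues
          w-path = bumps-determined w i≤ (trans w-length r≡) w-trues
          R = realise (outer σ) (inner π) v w (trans v-length (sym w-length))
                (trans (cong (λ p → size p + size (inner π) + 2) v-path) (size-coordinates π))
          open Realisation R
      in (chain , ≡⇒≈𝔅 (start chain) π (trans start-outer v-path) start-inner
                , ≡⇒≈𝔅 (end chain) σ end-outer (trans end-inner w-path))
         , cong₂ _,_ (MarkedWord-≡ outerWord-≡) (MarkedWord-≡ innerWord-≡))

-- Maximal chains

origin : ℕ × ℕ
origin = 0 , 0

-- A unit left in the inner pair could be returned to the outer pair, giving a smaller element.
minimal⇒inner : ∀ (π : 𝔅 n) → Minimal π → inner π ≡ origin
minimal⇒inner π minimal with m≤n⇒m<n∨m≡n (size-mono {origin} {inner π} (z≤n , z≤n))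
... | inj₂ eq = sym (≤²-size-≡ (z≤n , z≤n) eq)
... | inj₁ lt =
  let γ , i , i≡ , _ = ≤²-bump⁻ (z≤n , z≤n) lt
      -- Either outer coordinate could receive the unit; `true` is an arbitrary choice.
      ρ , ρo , ρi = element (bump true (outer π)) i (trans
        (cong (_+ 2) (trans (sym (size-exchange true (outer π) γ i)) (cong (λ p → size (outer π) + size p) (sym i≡))))
        (size-coordinates π))
      ρ≈π = minimal ρ (≤²⇒≤𝔅 ρ π (subst (outer π ≤²_) (sym ρo) (≤²-bump true _))
              (subst₂ _≤²_ (sym ρi) (sym i≡) (≤²-bump γ i)))
  in contradiction (trans (sym ρi) (trans (proj₂ (≈𝔅⇒≡ ρ π ρ≈π)) i≡)) (≢-bump γ i)

maximal⇒outer : ∀ (π : 𝔅 n) → Maximal π → outer π ≡ origin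
maximal⇒outer π maximal with m≤n⇒m<n∨m≡n (size-mono {origin} {outer π} (z≤n , z≤n))
... | inj₂ eq = sym (≤²-size-≡ (z≤n , z≤n) eq)
... | inj₁ lt =
  let β , o , o≡ , _ = ≤²-bump⁻ (z≤n , z≤n) lt
      ρ , ρo , ρi = element o (bump true (inner π)) (trans
        (cong (_+ 2) (trans (size-exchange β o true (inner π)) (cong (λ p → size p + size (inner π)) (sym o≡))))
        (size-coordinates π))
      ρ≈π = maximal ρ (≤²⇒≤𝔅 π ρ (subst₂ _≤²_ (sym ρo) (sym o≡) (≤²-bump β o))
              (subst (inner π ≤²_) (sym ρi) (≤²-bump true _)))
  in contradiction (trans (sym ρo) (trans (proj₁ (≈𝔅⇒≡ ρ π ρ≈π)) o≡)) (≢-bump β o)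

inner⇒minimal : ∀ (π : 𝔅 n) → inner π ≡ origin → Minimal π
inner⇒minimal π i≡ ρ ρ≤π =
  let o≤ , i≤ = ≤𝔅⇒≤² ρ π ρ≤π
      ρi≡πi = ≤²-antisym i≤ (subst (_≤² inner ρ) (sym i≡) (z≤n , z≤n))
  in ≡⇒≈𝔅 ρ π (sym (≤²-size-≡ o≤ (+-cancelʳ-≡ (size (inner π)) _ _
       (trans (sizes-≡ π ρ) (cong (λ p → size (outer ρ) + size p) ρi≡πi))))) ρi≡πi

outer⇒maximal : ∀ (π : 𝔅 n) → outer π ≡ origin → Maximal π
outer⇒maximal π o≡ ρ π≤ρ =
  let o≤ , i≤ = ≤𝔅⇒≤² π ρ π≤ρ
      ρo≡πo = ≤²-antisym o≤ (subst (_≤² outer ρ) (sym o≡) (z≤n , z≤n))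
  in ≡⇒≈𝔅 ρ π ρo≡πo (sym (≤²-size-≡ i≤ (+-cancelˡ-≡ (size (outer π)) _ _
       (trans (sizes-≡ π ρ) (cong (λ p → size p + size (inner ρ)) ρo≡πo)))))

module _ (x : SaturatedChain n) (maximal : MaximalChain x) where

  private
    start-inner : inner (start x) ≡ origin
    start-inner = minimal⇒inner (start x) (proj₁ maximal)

    start-size : size (outer (start x)) ≡ n ∸ 2
    start-size = sym (trans (cong (_∸ 2) (sym (size-coordinates (start x))))
      (trans (m+n∸n≡m (size (outer (start x)) + size (inner (start x))) 2)
      (trans (cong (λ p → size (outer (start x)) + size p) start-inner) (+-identityʳ _))))

  maximal-steps : steps x ≡ n ∸ 2
  maximal-steps = trans (sym (trans (cong size (outer-start (covers x))) (trans (size-bumps (outerWord (covers x)) _)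
    (trans (cong (λ p → length (outerWord (covers x)) + size p) (maximal⇒outer (end x) (proj₂ maximal)))
    (trans (+-identityʳ _) (length-outerWord (covers x))))))) start-size

  -- The start is not prescribed here, but the outer word leads back to it from the outer pair
  -- `origin` at the top.
  maximal-start : ∀ y → MaximalChain y → outerWord (covers x) ≡ outerWord (covers y) → start x ≈𝔅 start y
  maximal-start y maximal′ eq = ≡⇒≈𝔅 (start x) (start y)
    (trans (outer-start (covers x)) (trans (cong₂ bumps eq
      (trans (maximal⇒outer (end x) (proj₂ maximal)) (sym (maximal⇒outer (end y) (proj₂ maximal′)))))
      (sym (outer-start (covers y)))))
    (trans start-inner (sym (minimal⇒inner (start y) (proj₁ maximal′))))

4^≡2^*2^ : ∀ m → 2 ^ m * 2 ^ m ≡ 4 ^ m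
4^≡2^*2^ m = trans (sym (^-distribˡ-+-* 2 m m)) (trans (cong (λ k → 2 ^ (m + k)) (sym (+-identityʳ m)))
  (sym (^-*-assoc 2 2 m)))

maximal-cardinality : 2 ≤ n → HasCardinality (chainsSatisfying (MaximalChain {n})) (4 ^ (n ∸ 2))
maximal-cardinality {n} 2≤n = hasCardinality
  (subst (λ k → (Word N × Word N) ↔ Fin k) (4^≡2^*2^ N) (↔-sym *↔× ↔-∘ (words N ×-↔ words N)))
  (λ (x , m) →
    (outerWord (covers x) , trans (length-outerWord (covers x)) (maximal-steps x m)) ,
    (innerWord (covers x) , trans (length-innerWord (covers x)) (maximal-steps x m)))
  (λ {(x , _)} {(y , _)} x≈y → let os , is = words-cong (covers x) (covers y) x≈y
    in cong₂ _,_ (Word-≡ os) (Word-≡ is))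
  (λ {(x , m)} {(y , m′)} eq → let os = cong (λ ws → proj₁ (proj₁ ws)) eq
    in words-injective (covers x) (covers y) (maximal-start x m y m′ os) os (cong (λ ws → proj₁ (proj₂ ws)) eq))
  (λ ((v , v-length) , (w , w-length)) →
    let R = realise origin origin v w (trans v-length (sym w-length))
              (trans (cong (λ s → s + 0 + 2) (trans (size-bumps v origin) (+-identityʳ (length v))))
              -- Here `2 ≤ n` makes the subtraction in `n ∸ 2` exact.
              (trans (cong (_+ 2) (trans (+-identityʳ (length v)) v-length)) (m∸n+n≡m 2≤n)))
        open Realisation R
    in (chain , inner⇒minimal (start chain) start-inner , outer⇒maximal (end chain) end-outer)
       , cong₂ _,_ (Word-≡ outerWord-≡) (Word-≡ innerWord-≡))
  where
  N : ℕ
  N = n ∸ 2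

-- The counts in terms of length vectors

open import Data.Integer using (ℤ; +_; _⊖_) renaming (_+_ to _+ℤ_)
open import Data.Integer.Properties using (⊖-≥)

theorem3p4 : ∀ (n : ℕ) → 2 ≤ n →
    (∀ (π σ : 𝔅 n) (ℓ₁ ℓ₂ ℓ₃ ℓ₄ m₁ m₂ m₃ m₄ : ℕ) →
    HasLengthVector π ℓ₁ ℓ₂ ℓ₃ ℓ₄ →
    HasLengthVector σ m₁ m₂ m₃ m₄ →
    π ≤𝔅 σ →
    let r = (ℓ₁ ⊖ m₁) +ℤ (ℓ₄ ⊖ m₄) in
    (∀ (x : SaturatedChain n) → Between π σ x → + steps x ≡ r)
    × HasCardinality (chainsSatisfying (Between π σ))
    (binomial r (ℓ₁ ⊖ m₁) * binomial r (m₂ ⊖ ℓ₂)))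
    × HasCardinality (chainsSatisfying (MaximalChain {n})) (4 ^ (n ∸ 2))
theorem3p4 n 2≤n .proj₁ π σ _ _ _ _ _ _ _ _ π-vector σ-vector π≤σ
  with a , y , u , v , s , refl , refl , refl , refl ← lengthVector-shape π π-vector
     | a′ , y′ , u′ , v′ , t , refl , refl , refl , refl ← lengthVector-shape σ σ-vector
  with πo , πi ← shape-coordinates π (λ _ → refl) s | σo , σi ← shape-coordinates σ (λ _ → refl) t
  with o≤ , i≤ ← ≤𝔅⇒≤² π σ π≤σ
  -- The comparison of pairs makes all three differences non-negative, so integer subtraction
  -- becomes `∸` and `binomial` computes.
  rewrite ⊖-≥ (s≤s (subst₂ _≤_ (cong proj₁ σo) (cong proj₁ πo) (proj₁ o≤)))
        | ⊖-≥ (s≤s (subst₂ _≤_ (cong proj₂ σo) (cong proj₂ πo) (proj₂ o≤)))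
        | ⊖-≥ (s≤s (subst₂ _≤_ (cong proj₁ πi) (cong proj₁ σi) (proj₁ i≤))) =
  (λ x b → cong +_ (trans (between-steps π σ π≤σ x b) (cong₂ gap πo σo)))
  , subst (HasCardinality (chainsSatisfying (Between π σ)))
      (cong₂ _*_ (cong₂ _C_ (cong₂ gap πo σo) (cong₂ (λ p q → proj₁ p ∸ proj₁ q) πo σo))
                 (cong₂ _C_ (cong₂ gap πo σo) (cong₂ (λ p q → proj₁ p ∸ proj₁ q) σi πi)))
      (between-cardinality π σ π≤σ)
theorem3p4 n 2≤n .proj₂ = maximal-cardinality 2≤n
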